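{- Let $\Gamma$ be a nontrivial finite abelian group, and let $n\ge 3$ be an integer. Let $M$ be a lift of the graphic matroid $M(K_n^{\Gamma})$ so that a cycle of $K_n^{\Gamma}$ is a circuit of $M$ if and only if it is balanced. Then either $\Gamma\cong\mathbb{Z}_p^j$ for some prime $p$ and integer $j\ge 2$, or $M$ is an elementary lift of $M(K_n^{\Gamma})$.
   Context: $\mathbb{Z}_p^j$ is the direct sum of $j$ copies of the cyclic group of order $p$. For a finite group $\Gamma$ and integer $n\ge 3$, $K_n^{\Gamma}$ is the (multi)graph with vertex set $[n]=\{1,\dots,n\}$ and edge set $\binom{[n]}{2}\times\Gamma$, where the edge $(\{i,j\},\alpha)$ joins vertices $i$ and $j$. For $i<j$ the edge $e=(\{i,j\},\alpha)$ is oriented from $i$ to $j$ and has label $\phi(e)=\alpha$. For a walk $W$ with edge sequence $e_1,\dots,e_k$, put $\phi(W)=\prod_{t=1}^k\phi(e_t)^{c_t}$ (group written multiplicatively), where $c_t=1$ if $e_t$ is traversed forward in $W$ and $c_t=-1$ if it is traversed backward. A cycle $C$ of $K_n^{\Gamma}$ (including cycles consisting of two parallel edges) is balanced if some (equivalently, every) simple closed walk $W$ around $C$ has $\phi(W)$ equal to the identity of $\Gamma$. Cycles are identified with their edge sets. $M(G)$ is the graphic (cycle) matroid of a graph $G$. A matroid $K$ is a lift of a matroid $M$ if there is a matroid $P$ and a subset $X$ of $E(P)$ so that $P\setminus X=K$ and $P/X=M$. A matroid $M'$ is an elementary lift of $M$ if there is a matroid $P$ with ground set $E(M)\cup\{e\}$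 (with $e\notin E(M)$) so that $P\setminus e=M'$ and $P/e=M$. -}

module Defs where

open import Algebra.Bundles using (AbelianGroup)
import Algebra.Construct.Pointwise as Pointwise
open import Algebra.Morphism.Structures using (module GroupMorphisms)
open import Data.Bool.Base using (_∨_)
open import Data.Empty using (⊥-elim)
open import Data.Fin.Base using (Fin; _↑ˡ_; _↑ʳ_; splitAt)
open import Data.Fin.Properties using (splitAt⁻¹-↑ˡ; splitAt⁻¹-↑ʳ) renaming (_<?_ to _<ᶠ?_)
open import Data.Fin.Subset using (Subset; inside; outside; ⊥; ⁅_⁆; _∪_; ⋃; ∣_∣; _∈_; _∉_; _⊆_; _⊂_; _⊃_)
open import Data.Fin.Subset.Induction using (⊃-wellFounded)
open import Data.Fin.Subset.Properties using (anySubset?; _⊂?_; ∉⊥; ⊥⊆; x∈⁅x⁆; p⊆p∪q; q⊆p∪q; ∪-identityʳ)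
open import Data.Integer.Base as ℤ using (ℤ; +_)
import Data.Integer.Divisibility.Signed as ℤ∣
import Data.Integer.Properties as ℤ
open import Data.Integer.Tactic.RingSolver using (solve-∀)
open import Data.List.Base using (List; []; _∷_; map; filter; cartesianProduct; allFin; length; lookup)
open import Data.List.Relation.Unary.Unique.Propositional using (Unique)
open import Data.Nat.Base as ℕ using (ℕ; suc; _+_; _<_; _≤_)
import Data.Nat.Properties as ℕ
open import Data.Product.Base using (Σ; ∃; ∃-syntax; _×_; _,_; proj₁; proj₂)
open import Data.Sum.Base using (inj₁; inj₂)
open import Data.Vec.Base as Vec using ([]; _∷_; _++_)
open import Data.Vec.Properties using ([]=⇒lookup; lookup⇒[]=; lookup-++ˡ; lookup-++ʳ; zipWith-++)
open import Function.Base using (_∘_)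
open import Function.Bundles using (Inverse; _⇔_)
open import Induction.WellFounded using (Acc; acc)
open import Level using (_⊔_) renaming (suc to lsuc)
open import Relation.Binary.Construct.Closure.ReflexiveTransitive using (Star; ε; _◅_)
open import Relation.Binary.PropositionalEquality using (_≡_; _≢_; refl; sym; trans; cong; subst; setoid)
open import Relation.Nullary using (¬_; Dec; yes; no; contradiction)
open import Relation.Nullary.Decidable using (map′; ¬?; _×-dec_)
open import Relation.Unary using (Decidable)

private
  variable
    m k : ℕ

record FiniteAbelianGroup c ℓ : Set (lsuc (c ⊔ ℓ)) where
  field
    abelianGroup : AbelianGroup c ℓ
  open AbelianGroup abelianGroup public renaming (setoid to ≈-setoid)
  field
    order       : ℕ
    enumeration : Inverse ≈-setoid (setoid (Fin order))

Nontrivial : ∀ {c ℓ} → FiniteAbelianGroup c ℓ → Set (c ⊔ ℓ)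
Nontrivial Γ = ∃[ x ] ¬ (x ≈ 1#)
  where open FiniteAbelianGroup Γ renaming (ε to 1#)

_≅_ : ∀ {c₁ ℓ₁ c₂ ℓ₂} → AbelianGroup c₁ ℓ₁ → AbelianGroup c₂ ℓ₂ → Set (c₁ ⊔ ℓ₁ ⊔ c₂ ⊔ ℓ₂)
G ≅ H = ∃[ f ] IsGroupIsomorphism f
  where open GroupMorphisms (AbelianGroup.rawGroup G) (AbelianGroup.rawGroup H)

-- The cyclic group of order p, as the integers with congruence modulo p for
-- equality.
ℤ/ : ℕ → AbelianGroup _ _
ℤ/ p = record
  { Carrier = ℤ
  ; _≈_     = _≈_
  ; _∙_     = ℤ._+_
  ; ε       = ℤ.0ℤ
  ; _⁻¹     = ℤ.-_
  ; isAbelianGroup = record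
    { isGroup = record
      { isMonoid = record
        { isSemigroup = record
          { isMagma = record
            { isEquivalence = record
              { refl  = λ {a} → reflexive {a} refl
              ; sym   = λ {a} {b} a≈b → subst (+ p ℤ∣.∣_) (neg-sub a b) (ℤ∣.∣m⇒∣-m a≈b)
              ; trans = λ {a} {b} {c} a≈b b≈c → subst (+ p ℤ∣.∣_) (sub-sub a b c) (ℤ∣.∣m∣n⇒∣m+n a≈b b≈c)
              }
            ; ∙-cong = λ {a} {b} {c} {d} a≈b c≈d → subst (+ p ℤ∣.∣_) (add-sub a b c d) (ℤ∣.∣m∣n⇒∣m+n a≈b c≈d)
            }
          ; assoc = λ a b c → reflexive (ℤ.+-assoc a b c)
          }
        ; identity = (λ a → reflexive (ℤ.+-identityˡ a)) , (λ a → reflexive (ℤ.+-identityʳ a))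
        }
      ; inverse = (λ a → reflexive (ℤ.+-inverseˡ a)) , (λ a → reflexive (ℤ.+-inverseʳ a))
      ; ⁻¹-cong = λ {a} {b} a≈b → subst (+ p ℤ∣.∣_) (neg-neg a b) (ℤ∣.∣m⇒∣-m a≈b)
      }
    ; comm = λ a b → reflexive (ℤ.+-comm a b)
    }
  }
  where
  _≈_ : ℤ → ℤ → Set
  a ≈ b = + p ℤ∣.∣ a ℤ.- b

  reflexive : ∀ {a b} → a ≡ b → a ≈ b
  reflexive {a} refl = ℤ∣.divides ℤ.0ℤ (ℤ.+-inverseʳ a)

  neg-sub : ∀ a b → ℤ.- (a ℤ.- b) ≡ b ℤ.- a
  neg-sub = solve-∀

  neg-neg : ∀ a b → ℤ.- (a ℤ.- b) ≡ ℤ.- a ℤ.- (ℤ.- b)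
  neg-neg = solve-∀

  sub-sub : ∀ a b c → (a ℤ.- b) ℤ.+ (b ℤ.- c) ≡ a ℤ.- c
  sub-sub = solve-∀

  add-sub : ∀ a b c d → (a ℤ.- b) ℤ.+ (c ℤ.- d) ≡ (a ℤ.+ c) ℤ.- (b ℤ.+ d)
  add-sub = solve-∀

-- Finite direct sums are powers.
_^⊕_ : ∀ {c ℓ} → AbelianGroup c ℓ → ℕ → AbelianGroup c ℓ
G ^⊕ j = Pointwise.abelianGroup (Fin j) G

-- Independence is decidable, as it is classically for every finite matroid.
record Matroid (m : ℕ) : Set₁ where
  field
    Indep   : Subset m → Set
    indep?  : Decidable Indep
    ⊥-indep : Indep ⊥
    ⊆-indep : ∀ {I J} → I ⊆ J → Indep J → Indep I
    augment : ∀ {I J} → Indep I → Indep J → ∣ I ∣ < ∣ J ∣ →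
              ∃[ x ] x ∈ J × x ∉ I × Indep (I ∪ ⁅ x ⁆)

open Matroid

infix 4 _≐_
_≐_ : Matroid m → Matroid m → Set
M ≐ N = ∀ S → Indep M S ⇔ Indep N S

IsCircuit : Matroid m → Subset m → Set
IsCircuit M C = ¬ Indep M C × (∀ {D} → D ⊂ C → Indep M D)

-- The ground set Fin (m + k) is regarded as the disjoint union E ⊎ X of its
-- first m and its last k elements: S ++ T is the union of S ⊆ E and T ⊆ X.
-- The matroids delete m k P and contract m k P on E are P \ X and P / X.

∈-++⁺ˡ : ∀ {S : Subset m} {T : Subset k} {x} → x ∈ S → (x ↑ˡ k) ∈ S ++ T
∈-++⁺ˡ {S = S} {T} {x} x∈S = lookup⇒[]= _ (S ++ T) (trans (lookup-++ˡ S T x) ([]=⇒lookup x∈S))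

∈-++⁻ˡ : ∀ {S : Subset m} {T : Subset k} {x} → (x ↑ˡ k) ∈ S ++ T → x ∈ S
∈-++⁻ˡ {S = S} {T} {x} x∈ = lookup⇒[]= x S (trans (sym (lookup-++ˡ S T x)) ([]=⇒lookup x∈))

∈-++⁺ʳ : ∀ {S : Subset m} {T : Subset k} {y} → y ∈ T → (m ↑ʳ y) ∈ S ++ T
∈-++⁺ʳ {S = S} {T} {y} y∈T = lookup⇒[]= _ (S ++ T) (trans (lookup-++ʳ S T y) ([]=⇒lookup y∈T))

∈-++⁻ʳ : ∀ {S : Subset m} {T : Subset k} {y} → (m ↑ʳ y) ∈ S ++ T → y ∈ T
∈-++⁻ʳ {S = S} {T} {y} y∈ = lookup⇒[]= y T (trans (sym (lookup-++ʳ S T y)) ([]=⇒lookup y∈))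

data Summand m k : Fin (m + k) → Set where
  inˡ : ∀ x → Summand m k (x ↑ˡ k)
  inʳ : ∀ y → Summand m k (m ↑ʳ y)

summand : ∀ m k i → Summand m k i
summand m k i with splitAt m i in eq
... | inj₁ x = subst (Summand m k) (splitAt⁻¹-↑ˡ eq) (inˡ x)
... | inj₂ y = subst (Summand m k) (splitAt⁻¹-↑ʳ eq) (inʳ y)

++-mono-⊆ : ∀ {S S′ : Subset m} {T T′ : Subset k} → S ⊆ S′ → T ⊆ T′ → S ++ T ⊆ S′ ++ T′
++-mono-⊆ {m = m} {k} S⊆ T⊆ {i} i∈ with summand m k i
... | inˡ x = ∈-++⁺ˡ (S⊆ (∈-++⁻ˡ i∈))
... | inʳ y = ∈-++⁺ʳ (T⊆ (∈-++⁻ʳ i∈))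

∣++∣ : ∀ (S : Subset m) (T : Subset k) → ∣ S ++ T ∣ ≡ ∣ S ∣ + ∣ T ∣
∣++∣ []            T = refl
∣++∣ (inside  ∷ S) T = cong suc (∣++∣ S T)
∣++∣ (outside ∷ S) T = ∣++∣ S T

⊥++⊥ : ∀ m k → ⊥ {m} ++ ⊥ {k} ≡ ⊥
⊥++⊥ ℕ.zero  k = refl
⊥++⊥ (suc m) k = cong (outside ∷_) (⊥++⊥ m k)

⁅↑ˡ⁆ : ∀ (x : Fin m) → ⁅ x ↑ˡ k ⁆ ≡ ⁅ x ⁆ ++ ⊥
⁅↑ˡ⁆ {suc m} {k} Fin.zero    = cong (inside ∷_) (sym (⊥++⊥ m k))
⁅↑ˡ⁆             (Fin.suc x) = cong (outside ∷_) (⁅↑ˡ⁆ x)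

⁅↑ʳ⁆ : ∀ m (y : Fin k) → ⁅ m ↑ʳ y ⁆ ≡ ⊥ {m} ++ ⁅ y ⁆
⁅↑ʳ⁆ ℕ.zero  y = refl
⁅↑ʳ⁆ (suc m) y = cong (outside ∷_) (⁅↑ʳ⁆ m y)

∪⁅↑ˡ⁆ : ∀ (S : Subset m) (T : Subset k) x → (S ++ T) ∪ ⁅ x ↑ˡ k ⁆ ≡ (S ∪ ⁅ x ⁆) ++ T
∪⁅↑ˡ⁆ S T x = trans (cong ((S ++ T) ∪_) (⁅↑ˡ⁆ x))
  (trans (zipWith-++ _∨_ S T ⁅ x ⁆ ⊥) (cong ((S ∪ ⁅ x ⁆) ++_) (∪-identityʳ T)))

∪⁅↑ʳ⁆ : ∀ (S : Subset m) (T : Subset k) y → (S ++ T) ∪ ⁅ m ↑ʳ y ⁆ ≡ S ++ (T ∪ ⁅ y ⁆)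
∪⁅↑ʳ⁆ {m} S T y = trans (cong ((S ++ T) ∪_) (⁅↑ʳ⁆ m y))
  (trans (zipWith-++ _∨_ S T ⊥ ⁅ y ⁆) (cong (_++ (T ∪ ⁅ y ⁆)) (∪-identityʳ S)))

delete : ∀ m k → Matroid (m + k) → Matroid m
delete m k P = record
  { Indep   = λ S → Indep P (S ++ ⊥)
  ; indep?  = λ S → indep? P (S ++ ⊥)
  ; ⊥-indep = subst (Indep P) (sym (⊥++⊥ m k)) (⊥-indep P)
  ; ⊆-indep = λ I⊆J → ⊆-indep P (++-mono-⊆ I⊆J (λ y∈ → y∈))
  ; augment = aug
  }
  where
  aug : ∀ {I J : Subset m} → Indep P (I ++ ⊥) → Indep P (J ++ ⊥) → ∣ I ∣ < ∣ J ∣ →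
        ∃[ x ] x ∈ J × x ∉ I × Indep P ((I ∪ ⁅ x ⁆) ++ ⊥)
  aug {I} {J} indI indJ I<J
    with i , i∈J , i∉I , ind ← augment P indI indJ
           (subst (_< _) (sym (∣++∣ I (⊥ {k}))) (subst (_ <_) (sym (∣++∣ J (⊥ {k}))) (ℕ.+-monoˡ-< ∣ ⊥ {k} ∣ I<J)))
    with summand m k i
  ... | inˡ x = x , ∈-++⁻ˡ i∈J , i∉I ∘ ∈-++⁺ˡ , subst (Indep P) (∪⁅↑ˡ⁆ I ⊥ x) ind
  ... | inʳ y = contradiction (∈-++⁻ʳ {S = J} i∈J) ∉⊥

IsBasisOfX : ∀ m k → Matroid (m + k) → Subset k → Set
IsBasisOfX m k P B = Indep P (⊥ {m} ++ B) × (∀ {D} → B ⊂ D → ¬ Indep P (⊥ {m} ++ D))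

module _ (m k : ℕ) (P : Matroid (m + k)) where

  private
    IndX : Subset k → Set
    IndX B = Indep P (⊥ {m} ++ B)

    larger? : ∀ B → Dec (∃[ D ] B ⊂ D × IndX D)
    larger? B = anySubset? λ D → (B ⊂? D) ×-dec indep? P (⊥ ++ D)

    ⊂-∪⁅⁆ : ∀ {B : Subset k} {y} → y ∉ B → B ⊂ B ∪ ⁅ y ⁆
    ⊂-∪⁅⁆ {B} {y} y∉B = p⊆p∪q ⁅ y ⁆ , y , q⊆p∪q B ⁅ y ⁆ (x∈⁅x⁆ y) , y∉B

    -- A basis of X cannot be enlarged by an element of X, even after adding
    -- elements of E.
    blocked : ∀ {I B y} → IsBasisOfX m k P B → y ∉ B → ¬ Indep P ((I ++ B) ∪ ⁅ m ↑ʳ y ⁆)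
    blocked {I} {B} {y} (_ , max) y∉B ind =
      max (⊂-∪⁅⁆ y∉B) (⊆-indep P (++-mono-⊆ {S = ⊥ {m}} {I} ⊥⊆ (λ z∈ → z∈)) (subst (Indep P) (∪⁅↑ʳ⁆ I B y) ind))

    basis-≤ : ∀ {B B′} → IsBasisOfX m k P B → IsBasisOfX m k P B′ → ∣ B′ ∣ ≤ ∣ B ∣
    basis-≤ {B} {B′} bas bas′ = ℕ.≮⇒≥ impossible
      where
      impossible : ¬ (∣ B ∣ < ∣ B′ ∣)
      impossible B<B′
        with i , i∈ , i∉ , ind ← augment P (proj₁ bas) (proj₁ bas′)
               (subst (_< _) (sym (∣++∣ (⊥ {m}) B)) (subst (_ <_) (sym (∣++∣ (⊥ {m}) B′)) (ℕ.+-monoʳ-< ∣ ⊥ {m} ∣ B<B′)))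
        with summand m k i
      ... | inˡ x = ∉⊥ (∈-++⁻ˡ i∈)
      ... | inʳ y = blocked bas (i∉ ∘ ∈-++⁺ʳ) ind

    extend : ∀ B → Acc _⊃_ B → IndX B → ∃ (IsBasisOfX m k P)
    extend B (acc rec) ind with larger? B
    ... | yes (D , B⊂D , indD) = extend D (rec B⊂D) indD
    ... | no  none             = B , ind , λ B⊂D indD → none (_ , B⊂D , indD)

  basisOfX : ∃ (IsBasisOfX m k P)
  basisOfX = extend ⊥ (⊃-wellFounded ⊥) (subst (Indep P) (sym (⊥++⊥ m k)) (⊥-indep P))

  isBasisOfX? : Decidable (IsBasisOfX m k P)
  isBasisOfX? B = map′ to from (indep? P (⊥ ++ B) ×-dec ¬? (larger? B))
    where
    to : IndX B × ¬ (∃[ D ] B ⊂ D × IndX D) → IsBasisOfX m k P B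
    to (ind , none) = ind , λ B⊂D indD → none (_ , B⊂D , indD)

    from : IsBasisOfX m k P B → IndX B × ¬ (∃[ D ] B ⊂ D × IndX D)
    from (ind , max) = ind , λ (_ , B⊂D , indD) → max B⊂D indD

  contract : Matroid m
  contract = record
    { Indep   = λ S → ∃[ B ] IsBasisOfX m k P B × Indep P (S ++ B)
    ; indep?  = λ S → anySubset? λ B → isBasisOfX? B ×-dec indep? P (S ++ B)
    ; ⊥-indep = let B , bas = basisOfX in B , bas , proj₁ bas
    ; ⊆-indep = λ I⊆J (B , bas , ind) → B , bas , ⊆-indep P (++-mono-⊆ I⊆J (λ y∈ → y∈)) ind
    ; augment = aug
    }
    where
    Ind/ : Subset m → Set
    Ind/ S = ∃[ B ] IsBasisOfX m k P B × Indep P (S ++ B)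

    aug : ∀ {I J} → Ind/ I → Ind/ J → ∣ I ∣ < ∣ J ∣ → ∃[ x ] x ∈ J × x ∉ I × Ind/ (I ∪ ⁅ x ⁆)
    aug {I} {J} (B , bas , ind) (B′ , bas′ , ind′) I<J
      with i , i∈ , i∉ , ind″ ← augment P ind ind′
             (subst (_< _) (sym (∣++∣ I B)) (subst (_ <_) (sym (∣++∣ J B′)) (ℕ.+-mono-<-≤ I<J (basis-≤ bas′ bas))))
      with summand m k i
    ... | inˡ x = x , ∈-++⁻ˡ i∈ , i∉ ∘ ∈-++⁺ˡ , B , bas , subst (Indep P) (∪⁅↑ˡ⁆ I B x) ind″
    ... | inʳ y = ⊥-elim (blocked bas (i∉ ∘ ∈-++⁺ʳ) ind″)

-- As E(P) is the disjoint union of E(M) and X, its elements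
-- can be numbered with those of E(M) first and those of X last.
IsLift : Matroid m → Matroid m → Set₁
IsLift {m} K M = ∃[ k ] Σ (Matroid (m + k)) λ P → delete m k P ≐ K × contract m k P ≐ M

IsElementaryLift : Matroid m → Matroid m → Set₁
IsElementaryLift {m} K M = Σ (Matroid (m + 1)) λ P → delete m 1 P ≐ K × contract m 1 P ≐ M

-- Multigraphs; tail and head give a reference orientation of each edge.
record Graph : Set where
  field
    vertices edges : ℕ
    tail head      : Fin edges → Fin vertices

module _ (G : Graph) where
  open Graph G

  data Step (u v : Fin vertices) : Set where
    forward  : ∀ e → tail e ≡ u → head e ≡ v → Step u v
    backward : ∀ e → head e ≡ u → tail e ≡ v → Step u v

  Walk : Fin vertices → Fin vertices → Set
  Walk = Star Step

module _ {G : Graph} where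
  open Graph G

  stepEdge : ∀ {u v} → Step G u v → Fin edges
  stepEdge (forward  e _ _) = e
  stepEdge (backward e _ _) = e

  walkEdges : ∀ {u v} → Walk G u v → List (Fin edges)
  walkEdges ε       = []
  walkEdges (s ◅ W) = stepEdge s ∷ walkEdges W

  -- The final vertex is left out, so that for a closed walk the base point is
  -- listed once.
  walkVertices : ∀ {u v} → Walk G u v → List (Fin vertices)
  walkVertices         ε       = []
  walkVertices {u = u} (s ◅ W) = u ∷ walkVertices W

  edgeSet : ∀ {u v} → Walk G u v → Subset edges
  edgeSet W = ⋃ (map ⁅_⁆ (walkEdges W))

  -- Distinctness of edges only matters for walks of length two, which must not
  -- go back along the edge they came from.
  record IsSimpleClosed {v} (W : Walk G v v) : Set where
    field
      nonempty         : W ≢ ε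
      distinctVertices : Unique (walkVertices W)
      distinctEdges    : Unique (walkEdges W)

module _ (G : Graph) where
  open Graph G

  IsWalkAround : Subset edges → ∀ {v} → Walk G v v → Set
  IsWalkAround C W = IsSimpleClosed W × edgeSet W ≡ C

  IsCycle : Subset edges → Set
  IsCycle C = ∃[ v ] Σ (Walk G v v) λ W → IsWalkAround C W

  -- N is the graphic matroid M(G): its circuits, which determine it, are the
  -- edge sets of cycles of G.
  IsGraphicMatroid : Matroid edges → Set
  IsGraphicMatroid N = ∀ C → IsCircuit N C ⇔ IsCycle C

module _ {c ℓ} (Γ : FiniteAbelianGroup c ℓ) (n : ℕ) where
  open FiniteAbelianGroup Γ using (Carrier; _≈_; _∙_; _⁻¹; order; enumeration) renaming (ε to 1#)

  -- (i , j , a) with i < j is the edge ({i , j} , α), where α is the a-th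
  -- element of Γ.
  edgeList : List (Fin n × Fin n × Fin order)
  edgeList = filter (λ (i , j , _) → i <ᶠ? j)
                    (cartesianProduct (allFin n) (cartesianProduct (allFin n) (allFin order)))

  K : Graph
  K = record
    { vertices = n
    ; edges    = length edgeList
    ; tail     = λ e → proj₁ (lookup edgeList e)
    ; head     = λ e → proj₁ (proj₂ (lookup edgeList e))
    }

  label : Fin (Graph.edges K) → Carrier
  label e = Inverse.from enumeration (proj₂ (proj₂ (lookup edgeList e)))

  stepGain : ∀ {u v} → Step K u v → Carrier
  stepGain (forward  e _ _) = label e
  stepGain (backward e _ _) = label e ⁻¹

  φ : ∀ {u v} → Walk K u v → Carrier
  φ ε       = 1#
  φ (s ◅ W) = stepGain s ∙ φ W

  IsBalanced : Subset (Graph.edges K) → Set ℓ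
  IsBalanced C = ∃[ v ] Σ (Walk K v v) λ W → IsWalkAround K C W × φ W ≈ 1#

-- Let E₁ be the set of edges labelled by the identity.  Its cycles are all
-- balanced, so M and N = M(K_n^Γ) have the same rank on E₁, while an edge with
-- another label is not a loop of M / E₁, because it forms an unbalanced digon
-- with an edge of E₁.  As balanced triangles are circuits of M, the classes of
-- parallel edges of M / E₁ joining the first two vertices are, with the identity
-- added, subgroups partitioning Γ.  If there is only one of them, then E₁ and one
-- further edge span M, so that r(M) ≤ r(N) + 1 and the lift is elementary.
-- Otherwise, elements of different parts are killed by the same integers, which
-- makes Γ an elementary abelian p-group with two independent elements.
module Submission where

open import Defs
import Algebra.Properties.CommutativeMonoid.Mult as Mult
import Algebra.Properties.CommutativeSemigroup as CommutativeSemigroup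
import Algebra.Properties.Group as GroupProperties
open import Algebra.Bundles using (AbelianGroup)
open import Data.Empty using (⊥-elim) renaming (⊥ to Empty)
open import Data.Fin.Base as Fin using (Fin; toℕ; fromℕ<; _↑ˡ_; _↑ʳ_)
open import Data.Fin.Properties using (any?; pigeonhole; _≟_; _<?_; <⇒≢; toℕ-fromℕ<)
open import Data.Fin.Subset
  using (Subset; Side; inside; outside; ⊥; ⊤; ⁅_⁆; _∪_; _-_; ∣_∣; _∈_; _∉_; _⊆_; _⊂_; _⊃_)
open import Data.Fin.Subset.Induction using (⊂-wellFounded; ⊃-wellFounded)
open import Data.Fin.Subset.Properties
  using ( _∈?_; _⊂?_; _⊆?_; anySubset?; ∉⊥; ⊥⊆; ⊆-max; ⊆-antisym; x∈⁅x⁆; x∈⁅y⁆⇒x≡y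
        ; p⊆p∪q; q⊆p∪q; x∈p∪q⁻; ∪-identityʳ; p⊆q⇒∣p∣≤∣q∣; p⊂q⇒∣p∣<∣q∣
        ; p─q⊆p; x∈p∧x≢y⇒x∈p-y; x∈p⇒p-x⊂p )
open import Data.Integer.Base as ℤ using (ℤ) renaming (+_ to pos)
import Data.Integer.Divisibility.Signed as ℤ∣
import Data.Integer.DivMod as ℤ
import Data.Integer.Properties as ℤ
open import Data.Integer.Tactic.RingSolver using (solve-∀)
open import Data.List.Base as List using ([]; _∷_; cartesianProduct; allFin)
open import Data.List.Membership.Propositional using () renaming (_∈_ to _∈ₗ_)
open import Data.List.Membership.Propositional.Properties
  using (∈-lookup; ∈-filter⁺; ∈-filter⁻; ∈-cartesianProduct⁺; ∈-allFin)
open import Data.List.Relation.Unary.All using (All; []; _∷_)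
open import Data.List.Relation.Unary.AllPairs using ([]; _∷_)
open import Data.List.Relation.Unary.Any using (index)
open import Data.List.Relation.Unary.Any.Properties using (lookup-index)
open import Data.List.Relation.Unary.Unique.Propositional using (Unique)
open import Data.Nat.Base as ℕ using (ℕ; zero; suc; _+_; _*_; _∸_; _≤_; _<_; z<s; s<s; s≤s)
open import Data.Nat.Coprimality using (Coprime; coprime-Bézout)
import Data.Nat.Divisibility as ℕ∣
open import Data.Nat.DivMod using (_%_; _/_; m≡m%n+[m/n]*n; m%n<n)
open import Data.Nat.GCD using (module Bézout)
open import Data.Nat.ListAction using (product)
open import Data.Nat.Primality using (Prime; prime⇒irreducible; ¬prime[0])
open import Data.Nat.Primality.Factorisation using (factorise; module PrimeFactorisation)
import Data.Nat.Properties as ℕ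
open import Data.Product.Base using (∃₂; ∃-syntax; _×_; _,_; proj₁; proj₂)
open import Data.Sum.Base using (_⊎_; inj₁; inj₂; [_,_]′; map₂)
open import Data.Vec.Base using (Vec; []; _∷_; _++_; here; there; take; lookup; splitAt; tabulate)
open import Data.Vec.Functional using (Vector) renaming (_∷_ to _◂_; [] to []ᵥ)
open import Data.Vec.Properties using ([]=⇒lookup; lookup⇒[]=; lookup∘tabulate; lookup-++ʳ; ++-injectiveˡ)
open import Function.Base using (_∘_; id)
open import Function.Bundles using (Inverse; Equivalence; _⇔_; mk⇔)
open import Function.Construct.Symmetry using (⇔-sym)
open import Induction.WellFounded using (Acc; acc)
open import Level using (Level; _⊔_)
open import Relation.Binary.Construct.Closure.ReflexiveTransitive using (ε; _◅_)
open import Relation.Binary.Definitions using () renaming (Decidable to Decidable₂)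
open import Relation.Binary.PropositionalEquality as ≡ using (_≡_; _≢_; refl; sym; trans; cong; cong₂; subst)
open import Relation.Nullary using (¬_; Dec; yes; no; does; contradiction)
open import Relation.Nullary.Decidable using (¬?; _×-dec_; map′; decidable-stable; dec-true; dec-false)
open import Relation.Unary using (Pred; Decidable)

-- The matroid `P` behind a lift may be large and far from a one-element extension, so it serves
-- only to show that N is a quotient of M. An element raising r_N then also raises r_M, so r_M - r_N
-- never decreases as a set grows, and this monotonicity is used in both directions. Upwards: an
-- unbalanced digon is dependent in N but independent in M, so the gap is positive on every set
-- containing it. Downwards: a gap of at most 1 on the ground set bounds the gap on every set, which
-- is what lets a one-element extension be built directly from M and N. Three vertices are what make
-- labels multiply: two consecutive edges of a balanced triangle labelled α and β force αβ on the
-- third, while edges of E₁ carry a label unchanged from one vertex pair to another. Commutativity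
-- enters the group theory through m(α + β) = mα + mβ. An integer killing α kills everything whose
-- part misses α; a detour through a second part then reaches the elements of the first one.

private
  variable
    m : ℕ
    S T U : Subset m
    x y : Fin m

-- Subsets of a finite set

∪-lub : S ⊆ U → T ⊆ U → S ∪ T ⊆ U
∪-lub {S = S} {T = T} S⊆U T⊆U x∈ = [ S⊆U , T⊆U ]′ (x∈p∪q⁻ S T x∈)

⁅⁆⊆ : x ∈ S → ⁅ x ⁆ ⊆ S
⁅⁆⊆ {S = S} x∈S y∈ = subst (_∈ S) (sym (x∈⁅y⁆⇒x≡y _ y∈)) x∈S

x∈S∪⁅x⁆ : ∀ (S : Subset m) x → x ∈ S ∪ ⁅ x ⁆
x∈S∪⁅x⁆ S x = q⊆p∪q S ⁅ x ⁆ (x∈⁅x⁆ x)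

∈-∪⁅⁆⁻ : y ∈ S ∪ ⁅ x ⁆ → y ∈ S ⊎ y ≡ x
∈-∪⁅⁆⁻ {S = S} {x = x} y∈ = map₂ (x∈⁅y⁆⇒x≡y x) (x∈p∪q⁻ S ⁅ x ⁆ y∈)

∪⁅⁆-mono : S ⊆ T → S ∪ ⁅ x ⁆ ⊆ T ∪ ⁅ x ⁆
∪⁅⁆-mono {T = T} {x = x} S⊆T = ∪-lub (p⊆p∪q ⁅ x ⁆ ∘ S⊆T) (q⊆p∪q T ⁅ x ⁆)

⊂-∪⁅⁆ : x ∉ S → S ⊂ S ∪ ⁅ x ⁆
⊂-∪⁅⁆ {x = x} {S = S} x∉S = p⊆p∪q ⁅ x ⁆ , x , x∈S∪⁅x⁆ S x , x∉S

∣∪⁅⁆∣≤ : ∀ (S : Subset m) x → ∣ S ∪ ⁅ x ⁆ ∣ ≤ suc ∣ S ∣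
∣∪⁅⁆∣≤ (inside  ∷ S) Fin.zero    rewrite ∪-identityʳ S = ℕ.n≤1+n _
∣∪⁅⁆∣≤ (outside ∷ S) Fin.zero    rewrite ∪-identityʳ S = ℕ.≤-refl
∣∪⁅⁆∣≤ (inside  ∷ S) (Fin.suc x) = s≤s (∣∪⁅⁆∣≤ S x)
∣∪⁅⁆∣≤ (outside ∷ S) (Fin.suc x) = ∣∪⁅⁆∣≤ S x

x∉p-x : ∀ (S : Subset m) x → x ∉ S - x
x∉p-x (_ ∷ S) Fin.zero    ()
x∉p-x (_ ∷ S) (Fin.suc x) (there x∈) = x∉p-x S x x∈

⊈⇒∃ : ∀ (S T : Subset m) → ¬ S ⊆ T → ∃[ x ] x ∈ S × x ∉ T
⊈⇒∃ S T S⊈T with any? (λ x → (x ∈? S) ×-dec ¬? (x ∈? T))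
... | yes found = found
... | no  none  = ⊥-elim (S⊈T S⊆T)
  where
  S⊆T : S ⊆ T
  S⊆T {x} x∈S with x ∈? T
  ... | yes x∈T = x∈T
  ... | no  x∉T = contradiction (x , x∈S , x∉T) none

⊆-induction : ∀ {p} (P : Subset m → Set p) → (∀ S x → P S → P (S ∪ ⁅ x ⁆)) → S ⊆ T → P S → P T
⊆-induction {m = m} {T = T} P step = go (⊃-wellFounded _)
  where
  go : ∀ {S} → Acc _⊃_ S → S ⊆ T → P S → P T
  go {S} (acc rec) S⊆T PS with T ⊆? S
  ... | yes T⊆S = subst P (⊆-antisym S⊆T T⊆S) PS
  ... | no  T⊈S with x , x∈T , x∉S ← ⊈⇒∃ T S T⊈S
    = go (rec (⊂-∪⁅⁆ x∉S)) (∪-lub S⊆T (⁅⁆⊆ x∈T)) (step S x PS)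

-- Rank and closure

module _ {m : ℕ} (M : Matroid m) where
  open Matroid M

  record IsBasis (B S : Subset m) : Set where
    field
      indep   : Indep B
      ⊆-set   : B ⊆ S
      maximal : ∀ {x} → x ∈ S → x ∉ B → ¬ Indep (B ∪ ⁅ x ⁆)

  basis⊇ : ∀ {I S} → Indep I → I ⊆ S → ∃[ B ] I ⊆ B × IsBasis B S
  basis⊇ {S = S} = go (⊃-wellFounded _)
    where
    go : ∀ {I} → Acc _⊃_ I → Indep I → I ⊆ S → ∃[ B ] I ⊆ B × IsBasis B S
    go {I} (acc rec) indI I⊆S
      with any? (λ x → (x ∈? S) ×-dec ¬? (x ∈? I) ×-dec indep? (I ∪ ⁅ x ⁆))
    ... | no none = I , id , record
      { indep = indI ; ⊆-set = I⊆S ; maximal = λ x∈S x∉I ind → none (_ , x∈S , x∉I , ind) }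
    ... | yes (x , x∈S , x∉I , ind)
      with B , I∪x⊆B , isB ← go (rec (⊂-∪⁅⁆ x∉I)) ind (∪-lub I⊆S (⁅⁆⊆ x∈S))
      = B , I∪x⊆B ∘ p⊆p∪q ⁅ x ⁆ , isB

  basis-max : ∀ {B S I} → IsBasis B S → Indep I → I ⊆ S → ∣ I ∣ ≤ ∣ B ∣
  basis-max {B} isB indI I⊆S = ℕ.≮⇒≥ λ B<I →
    let x , x∈I , x∉B , ind = augment (IsBasis.indep isB) indI B<I
    in IsBasis.maximal isB (I⊆S x∈I) x∉B ind

  abstract
    basis : ∀ S → ∃[ B ] IsBasis B S
    basis S = let B , _ , isB = basis⊇ ⊥-indep ⊥⊆ in B , isB

    rank : Subset m → ℕ
    rank S = ∣ proj₁ (basis S) ∣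

    ∣basis∣ : ∀ {B S} → IsBasis B S → ∣ B ∣ ≡ rank S
    ∣basis∣ {S = S} isB = let _ , isB′ = basis S in ℕ.≤-antisym
      (basis-max isB′ (IsBasis.indep isB) (IsBasis.⊆-set isB))
      (basis-max isB (IsBasis.indep isB′) (IsBasis.⊆-set isB′))

  ∣indep∣≤rank : ∀ {I S} → Indep I → I ⊆ S → ∣ I ∣ ≤ rank S
  ∣indep∣≤rank {S = S} indI I⊆S =
    let B , isB = basis S in subst (_ ≤_) (∣basis∣ isB) (basis-max isB indI I⊆S)

  rank≤ : ∀ {S k} → (∀ {I} → Indep I → I ⊆ S → ∣ I ∣ ≤ k) → rank S ≤ k
  rank≤ {S} bound =
    let B , isB = basis S in subst (_≤ _) (∣basis∣ isB) (bound (IsBasis.indep isB) (IsBasis.⊆-set isB))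

  augment-rank : ∀ {I S} → Indep I → ∣ I ∣ < rank S → ∃[ x ] x ∈ S × x ∉ I × Indep (I ∪ ⁅ x ⁆)
  augment-rank {I} {S} indI I<r =
    let B , isB = basis S
        x , x∈B , x∉I , ind = augment indI (IsBasis.indep isB) (subst (_ <_) (sym (∣basis∣ isB)) I<r)
    in x , IsBasis.⊆-set isB x∈B , x∉I , ind

  rank-mono : S ⊆ T → rank S ≤ rank T
  rank-mono S⊆T = rank≤ λ indI I⊆S → ∣indep∣≤rank indI (S⊆T ∘ I⊆S)

  dep⇒rank<∣∣ : ¬ Indep S → rank S < ∣ S ∣
  dep⇒rank<∣∣ {S} dep with B , isB ← basis S with S ⊆? B
  ... | yes S⊆B = contradiction (⊆-indep S⊆B (IsBasis.indep isB)) dep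
  ... | no  S⊈B with x , x∈S , x∉B ← ⊈⇒∃ S _ S⊈B
    = subst (_< _) (∣basis∣ isB) (p⊂q⇒∣p∣<∣q∣ (IsBasis.⊆-set isB , x , x∈S , x∉B))

  -- A basis of S extends to a basis of S ∪ {x}; by its maximality in S, the only element that can
  -- be added is x.
  rank-∪⁅⁆≤ : ∀ S x → rank (S ∪ ⁅ x ⁆) ≤ suc (rank S)
  rank-∪⁅⁆≤ S x
    with B , isB ← basis S
    with B′ , B⊆B′ , isB′ ← basis⊇ {S = S ∪ ⁅ x ⁆} (IsBasis.indep isB) (p⊆p∪q ⁅ x ⁆ ∘ IsBasis.⊆-set isB)
    = begin
    rank (S ∪ ⁅ x ⁆) ≡⟨ ∣basis∣ isB′ ⟨
    ∣ B′ ∣           ≤⟨ p⊆q⇒∣p∣≤∣q∣ B′⊆B∪x ⟩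
    ∣ B ∪ ⁅ x ⁆ ∣    ≤⟨ ∣∪⁅⁆∣≤ B x ⟩
    suc ∣ B ∣        ≡⟨ cong suc (∣basis∣ isB) ⟩
    suc (rank S)     ∎
    where
    open ℕ.≤-Reasoning
    B′⊆B∪x : B′ ⊆ B ∪ ⁅ x ⁆
    B′⊆B∪x {y} y∈B′ with y ∈? B | ∈-∪⁅⁆⁻ (IsBasis.⊆-set isB′ y∈B′)
    ... | yes y∈B | _         = p⊆p∪q ⁅ x ⁆ y∈B
    ... | no  _   | inj₂ refl = x∈S∪⁅x⁆ B x
    ... | no  y∉B | inj₁ y∈S  = contradiction
      (⊆-indep (∪-lub B⊆B′ (⁅⁆⊆ y∈B′)) (IsBasis.indep isB′)) (IsBasis.maximal isB y∈S y∉B)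

  infix 4 _∈cl_
  -- Only `≤` is required, since the reverse inequality is monotonicity of rank. The relation is
  -- decidable, so membership can be proved by contradiction.
  _∈cl_ : Fin m → Subset m → Set
  x ∈cl S = rank (S ∪ ⁅ x ⁆) ≤ rank S

  ∈⇒∈cl : x ∈ S → x ∈cl S
  ∈⇒∈cl x∈S = rank-mono (∪-lub id (⁅⁆⊆ x∈S))

  -- Together with `∉cl-indep`, this lets closure be tested on any one basis of the set.
  indep-∉cl : ∀ {B} → IsBasis B S → x ∉ B → Indep (B ∪ ⁅ x ⁆) → ¬ x ∈cl S
  indep-∉cl {S} {x} {B} isB x∉B ind x∈cl = ℕ.<-irrefl refl (begin-strict
    rank S           ≡⟨ ∣basis∣ isB ⟨
    ∣ B ∣            <⟨ p⊂q⇒∣p∣<∣q∣ (⊂-∪⁅⁆ x∉B) ⟩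
    ∣ B ∪ ⁅ x ⁆ ∣    ≤⟨ ∣indep∣≤rank ind (∪⁅⁆-mono (IsBasis.⊆-set isB)) ⟩
    rank (S ∪ ⁅ x ⁆) ≤⟨ x∈cl ⟩
    rank S           ∎)
    where open ℕ.≤-Reasoning

  rank-∪-cl : (∀ {x} → x ∈ T → x ∈cl S) → rank (S ∪ T) ≤ rank S
  rank-∪-cl {T} {S} T⊆cl with B , isB ← basis S = ℕ.≮⇒≥ λ S<S∪T →
    let x , x∈ , x∉B , ind = augment-rank (IsBasis.indep isB) (subst (_< _) (sym (∣basis∣ isB)) S<S∪T)
    in [ (λ x∈S → IsBasis.maximal isB x∈S x∉B ind) , indep-∉cl isB x∉B ind ∘ T⊆cl ]′ (x∈p∪q⁻ S T x∈)

  ∉cl-indep : ∀ {B} → IsBasis B T → ¬ x ∈cl T → x ∉ B × Indep (B ∪ ⁅ x ⁆)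
  ∉cl-indep {T} {x} {B} isB x∉cl
    with y , y∈ , y∉B , ind ← augment-rank (IsBasis.indep isB)
           (subst (_< rank (T ∪ ⁅ x ⁆)) (sym (∣basis∣ isB)) (ℕ.≰⇒> x∉cl))
    with ∈-∪⁅⁆⁻ y∈
  ... | inj₁ y∈T  = contradiction ind (IsBasis.maximal isB y∈T y∉B)
  ... | inj₂ refl = y∉B , ind

  infix 4 _∈cl?_
  _∈cl?_ : ∀ x S → Dec (x ∈cl S)
  x ∈cl? S = rank (S ∪ ⁅ x ⁆) ℕ.≤? rank S

  -- A basis B of S extends to a basis B′ of T. If x could be added to B′, it could be added to B.
  cl-mono : S ⊆ T → x ∈cl S → x ∈cl T
  cl-mono {S} {T} {x} S⊆T x∈clS = decidable-stable (x ∈cl? T) λ x∉clT →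
    let B , isB          = basis S
        B′ , B⊆B′ , isB′ = basis⊇ (IsBasis.indep isB) (S⊆T ∘ IsBasis.⊆-set isB)
        x∉B′ , ind       = ∉cl-indep isB′ x∉clT
    in indep-∉cl isB (x∉B′ ∘ B⊆B′) (⊆-indep (∪⁅⁆-mono B⊆B′) ind) x∈clS

  cl-trans : (∀ {y} → y ∈ T → y ∈cl S) → x ∈cl T → x ∈cl S
  cl-trans {T} {S} {x} T⊆cl x∈clT = begin
    rank (S ∪ ⁅ x ⁆)       ≤⟨ rank-mono (∪⁅⁆-mono (p⊆p∪q T)) ⟩
    rank ((S ∪ T) ∪ ⁅ x ⁆) ≤⟨ cl-mono (q⊆p∪q S T) x∈clT ⟩
    rank (S ∪ T)           ≤⟨ rank-∪-cl T⊆cl ⟩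
    rank S                 ∎
    where open ℕ.≤-Reasoning

  -- Adding y already raises the rank of S by one, which is all that x could achieve, so S ∪ {y} has
  -- the full rank of S ∪ {x, y}.
  cl-exchange : y ∈cl S ∪ ⁅ x ⁆ → ¬ y ∈cl S → x ∈cl S ∪ ⁅ y ⁆
  cl-exchange {y} {S} {x} y∈cl y∉cl = begin
    rank ((S ∪ ⁅ y ⁆) ∪ ⁅ x ⁆) ≤⟨ rank-mono (∪-lub (∪⁅⁆-mono (p⊆p∪q ⁅ x ⁆)) (p⊆p∪q ⁅ y ⁆ ∘ q⊆p∪q S ⁅ x ⁆)) ⟩
    rank ((S ∪ ⁅ x ⁆) ∪ ⁅ y ⁆) ≤⟨ y∈cl ⟩
    rank (S ∪ ⁅ x ⁆)           ≤⟨ rank-∪⁅⁆≤ S x ⟩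
    suc (rank S)               ≤⟨ ℕ.≰⇒> y∉cl ⟩
    rank (S ∪ ⁅ y ⁆)           ∎
    where open ℕ.≤-Reasoning

  -- C - x is independent, hence inside a basis of S. That basis together with x contains C, so it
  -- is dependent.
  circuit-∈cl : ∀ {C} → IsCircuit M C → x ∈ C → C ⊆ S ∪ ⁅ x ⁆ → x ∈cl S
  circuit-∈cl {x} {S} {C} (dep , minimal) x∈C C⊆S∪x = decidable-stable (x ∈cl? S) λ x∉cl →
    let B , C-x⊆B , isB = basis⊇ (minimal (x∈p⇒p-x⊂p x∈C)) C-x⊆S
    in dep (⊆-indep (C⊆B∪x C-x⊆B) (proj₂ (∉cl-indep isB x∉cl)))
    where
    C-x⊆S : C - x ⊆ S
    C-x⊆S {y} y∈ with ∈-∪⁅⁆⁻ (C⊆S∪x (p─q⊆p C ⁅ x ⁆ y∈))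
    ... | inj₁ y∈S = y∈S
    ... | inj₂ refl = contradiction y∈ (x∉p-x C x)
    C⊆B∪x : ∀ {B} → C - x ⊆ B → C ⊆ B ∪ ⁅ x ⁆
    C⊆B∪x {B} C-x⊆B {y} y∈ with y ≟ x
    ... | yes refl = x∈S∪⁅x⁆ B x
    ... | no  y≢x  = p⊆p∪q ⁅ x ⁆ (C-x⊆B (x∈p∧x≢y⇒x∈p-y y∈ y≢x))

  dep⇒circuit : ∀ {S} → ¬ Indep S → ∃[ C ] C ⊆ S × IsCircuit M C
  dep⇒circuit = go (⊂-wellFounded _)
    where
    go : ∀ {S} → Acc _⊂_ S → ¬ Indep S → ∃[ C ] C ⊆ S × IsCircuit M C
    go {S} (acc rec) dep with anySubset? (λ D → (D ⊂? S) ×-dec ¬? (indep? D))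
    ... | yes (D , D⊂S , depD) = let C , C⊆D , circ = go (rec D⊂S) depD in C , proj₁ D⊂S ∘ C⊆D , circ
    ... | no none = S , id , dep , λ {D} D⊂S → decidable-stable (indep? D) (λ depD → none (D , D⊂S , depD))

infix 4 _∈cl[_]_
_∈cl[_]_ : Fin m → Matroid m → Subset m → Set
x ∈cl[ M ] S = _∈cl_ M x S

circuit-cl-closed : ∀ {m} (M : Matroid m) {C S x} → IsCircuit M C → x ∈ C →
                    (∀ {y} → y ∈ C → y ≢ x → y ∈cl[ M ] S) → x ∈cl[ M ] S
circuit-cl-closed M {C} {S} {x} circuit x∈C others =
  cl-trans M (λ y∈ → others (p─q⊆p C ⁅ x ⁆ y∈) λ { refl → x∉p-x C x y∈ })
    (circuit-∈cl M circuit x∈C C⊆)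
  where
  C⊆ : C ⊆ (C - x) ∪ ⁅ x ⁆
  C⊆ {y} y∈ with y ≟ x
  ... | yes refl = x∈S∪⁅x⁆ (C - x) x
  ... | no  y≢x  = p⊆p∪q ⁅ x ⁆ (x∈p∧x≢y⇒x∈p-y y∈ y≢x)

open Matroid

-- Lifts

take-++ : ∀ {a} {A : Set a} {m k} (xs : Vec A m) (ys : Vec A k) → take m (xs ++ ys) ≡ xs
take-++ {m = m} xs ys = sym (++-injectiveˡ xs _ (proj₂ (proj₂ (splitAt m (xs ++ ys)))))

++∷[]-view : ∀ (U : Subset (m + 1)) → ∃₂ λ S b → U ≡ S ++ b ∷ []
++∷[]-view {m} U with S , b ∷ [] , eq ← splitAt m U = S , b , eq

-- N is a quotient of M: the identity is a strong map from M to N. The contracted set of a lift does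
-- not occur here.
record IsStrongMap {m} (M N : Matroid m) : Set where
  field
    indep-preserved : ∀ {S} → Indep N S → Indep M S
    cl-preserved    : ∀ {S x} → x ∈cl[ M ] S → x ∈cl[ N ] S

module _ {m k : ℕ} (P : Matroid (m + k)) where

  delete-basis : ∀ {B S} → IsBasis (delete m k P) B S → IsBasis P (B ++ ⊥) (S ++ ⊥)
  delete-basis {B} {S} isB = record
    { indep   = IsBasis.indep isB
    ; ⊆-set   = ++-mono-⊆ (IsBasis.⊆-set isB) id
    ; maximal = max
    }
    where
    max : ∀ {i} → i ∈ S ++ ⊥ → i ∉ B ++ ⊥ → ¬ Indep P ((B ++ ⊥) ∪ ⁅ i ⁆)
    max {i} i∈ i∉ ind with summand m k i
    ... | inˡ x = IsBasis.maximal isB (∈-++⁻ˡ i∈) (i∉ ∘ ∈-++⁺ˡ) (subst (Indep P) (∪⁅↑ˡ⁆ B ⊥ x) ind)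
    ... | inʳ y = ∉⊥ (∈-++⁻ʳ {S = S} i∈)

  contract-basis : ∀ {B S X} → IsBasis (contract m k P) B S → IsBasisOfX m k P X → Indep P (B ++ X) →
                   IsBasis P (B ++ X) (S ++ ⊤)
  contract-basis {B} {S} {X} isB isX ind = record
    { indep   = ind
    ; ⊆-set   = ++-mono-⊆ (IsBasis.⊆-set isB) (⊆-max X)
    ; maximal = max
    }
    where
    max : ∀ {i} → i ∈ S ++ ⊤ → i ∉ B ++ X → ¬ Indep P ((B ++ X) ∪ ⁅ i ⁆)
    max {i} i∈ i∉ indi with summand m k i
    ... | inˡ x = IsBasis.maximal isB (∈-++⁻ˡ i∈) (i∉ ∘ ∈-++⁺ˡ) (X , isX , subst (Indep P) (∪⁅↑ˡ⁆ B X x) indi)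
    ... | inʳ y = proj₂ isX (⊂-∪⁅⁆ (i∉ ∘ ∈-++⁺ʳ {S = B}))
      (⊆-indep P (++-mono-⊆ {S = ⊥} {B} ⊥⊆ id) (subst (Indep P) (∪⁅↑ʳ⁆ B X y) indi))

  -- Closure in the deletion is closure in P, and closure in the contraction is closure in P after
  -- adding the whole contracted set. So the inclusion is monotonicity of closure in P.
  delete-contract-strong : IsStrongMap (delete m k P) (contract m k P)
  delete-contract-strong = record
    { indep-preserved = λ {S} (_ , _ , ind) → ⊆-indep P (++-mono-⊆ {S = S} {T = ⊥ {k}} id ⊥⊆) ind
    ; cl-preserved    = λ {S} {x} → cl {S} {x}
    }
    where
    cl : ∀ {S x} → x ∈cl[ delete m k P ] S → x ∈cl[ contract m k P ] S
    cl {S} {x} x∈cl = decidable-stable (_∈cl?_ (contract m k P) x S) λ x∉cl →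
      let B , isB             = basis (contract m k P) S
          x∉B , X , isX , ind = ∉cl-indep (contract m k P) isB x∉cl
          B++X                = contract-basis isB isX (⊆-indep P (++-mono-⊆ {S = B} {T = X} (p⊆p∪q ⁅ x ⁆) id) ind)
      in indep-∉cl P B++X (x∉B ∘ ∈-++⁻ˡ) (subst (Indep P) (sym (∪⁅↑ˡ⁆ B X x)) ind)
           (cl-mono P (++-mono-⊆ {S = S} {T = ⊥ {k}} id ⊥⊆) x∈clP)
      where
      x∈clP : (x ↑ˡ k) ∈cl[ P ] S ++ ⊥
      x∈clP = decidable-stable (_∈cl?_ P (x ↑ˡ k) (S ++ ⊥)) λ x∉cl →
        let B , isB   = basis (delete m k P) S
            x∉B , ind = ∉cl-indep P (delete-basis isB) x∉cl
        in indep-∉cl (delete m k P) isB (x∉B ∘ ∈-++⁺ˡ) (subst (Indep P) (∪⁅↑ˡ⁆ B ⊥ x) ind) x∈cl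

module _ {m : ℕ} {M N : Matroid m} where

  rank-≤-of-indep : (∀ {S} → Indep M S → Indep N S) → ∀ S → rank M S ≤ rank N S
  rank-≤-of-indep M⇒N S = rank≤ M λ ind I⊆S → ∣indep∣≤rank N (M⇒N ind) I⊆S

module _ {m : ℕ} {M N : Matroid m} (M≐N : M ≐ N) where

  ≐⇒rank-≡ : ∀ S → rank M S ≡ rank N S
  ≐⇒rank-≡ S = ℕ.≤-antisym
    (rank-≤-of-indep (Equivalence.to (M≐N _)) S) (rank-≤-of-indep (Equivalence.from (M≐N _)) S)

  ≐⇒cl : ∀ {S x} → x ∈cl[ M ] S → x ∈cl[ N ] S
  ≐⇒cl {S} {x} rewrite ≐⇒rank-≡ S | ≐⇒rank-≡ (S ∪ ⁅ x ⁆) = id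

lift⇒strong : ∀ {M N : Matroid m} → IsLift M N → IsStrongMap M N
lift⇒strong {m} {M} {N} (k , P , del , con) = record
  { indep-preserved = Equivalence.to (del _) ∘ indep-preserved ∘ Equivalence.from (con _)
  ; cl-preserved    = λ {S} {x} x∈ →
      ≐⇒cl con {S} {x} (cl-preserved (≐⇒cl (⇔-sym ∘ del) {S} {x} x∈))
  }
  where open IsStrongMap (delete-contract-strong {m} {k} P)

module _ {m : ℕ} {M N : Matroid m} (strong : IsStrongMap M N) where
  open IsStrongMap strong

  -- r_M − r_N is monotone; the terms are moved to avoid truncated subtraction.
  rank-gap-mono : ∀ {S T} → S ⊆ T → rank N T + rank M S ≤ rank M T + rank N S
  rank-gap-mono {S} S⊆T = ⊆-induction (λ T → rank N T + rank M S ≤ rank M T + rank N S)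
    step S⊆T (ℕ.≤-reflexive (ℕ.+-comm (rank N S) (rank M S)))
    where
    open ℕ.≤-Reasoning
    step : ∀ T x → rank N T + rank M S ≤ rank M T + rank N S →
           rank N (T ∪ ⁅ x ⁆) + rank M S ≤ rank M (T ∪ ⁅ x ⁆) + rank N S
    step T x ih with _∈cl?_ M x T
    ... | yes x∈cl = begin
      rank N (T ∪ ⁅ x ⁆) + rank M S ≤⟨ ℕ.+-monoˡ-≤ _ (cl-preserved x∈cl) ⟩
      rank N T + rank M S           ≤⟨ ih ⟩
      rank M T + rank N S           ≤⟨ ℕ.+-monoˡ-≤ _ (rank-mono M (p⊆p∪q ⁅ x ⁆)) ⟩
      rank M (T ∪ ⁅ x ⁆) + rank N S ∎
    ... | no x∉cl = begin
      rank N (T ∪ ⁅ x ⁆) + rank M S ≤⟨ ℕ.+-monoˡ-≤ _ (rank-∪⁅⁆≤ N T x) ⟩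
      suc (rank N T + rank M S)     ≤⟨ s≤s ih ⟩
      suc (rank M T + rank N S)     ≤⟨ ℕ.+-monoˡ-≤ _ (ℕ.≰⇒> x∉cl) ⟩
      rank M (T ∪ ⁅ x ⁆) + rank N S ∎

  module _ (gap≤1 : rank M ⊤ ≤ suc (rank N ⊤)) where

    private
      rank-gap≤1 : ∀ S → rank M S ≤ suc (rank N S)
      rank-gap≤1 S = ℕ.+-cancelˡ-≤ (rank N ⊤) _ _ (begin
        rank N ⊤ + rank M S       ≤⟨ rank-gap-mono (⊆-max S) ⟩
        rank M ⊤ + rank N S       ≤⟨ ℕ.+-monoˡ-≤ _ gap≤1 ⟩
        suc (rank N ⊤ + rank N S) ≡⟨ ℕ.+-suc (rank N ⊤) (rank N S) ⟨
        rank N ⊤ + suc (rank N S) ∎)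
        where open ℕ.≤-Reasoning

      -- An extension by an element e, whose membership is the last bit, is given
      -- by M on the sets avoiding e and by N on those containing it.
      Select : Side → Subset m → Set
      Select outside S = Indep M S
      Select inside  S = Indep N S

      select? : ∀ (b : Side) S → Dec (Select b S)
      select? outside = indep? M
      select? inside  = indep? N

      select⇒M : ∀ b {S} → Select b S → Indep M S
      select⇒M outside = id
      select⇒M inside  = indep-preserved

      Ind : Subset (m + 1) → Set
      Ind U = Select (lookup U (m ↑ʳ Fin.zero)) (take m U)

      ind-++ : ∀ S (b : Side) → Ind (S ++ b ∷ []) ≡ Select b S
      ind-++ S b = cong₂ Select (lookup-++ʳ S (b ∷ []) Fin.zero) (take-++ S (b ∷ []))

      to : ∀ S (b : Side) → Ind (S ++ b ∷ []) → Select b S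
      to S b = subst id (ind-++ S b)

      from : ∀ S (b : Side) → Select b S → Ind (S ++ b ∷ [])
      from S b = subst id (sym (ind-++ S b))

      Ind-⊆ : ∀ {I J} → I ⊆ J → Ind J → Ind I
      Ind-⊆ {I} {J} I⊆J ind with ++∷[]-view I | ++∷[]-view J
      ... | S , outside , refl | T , b , refl =
        from S outside (⊆-indep M (∈-++⁻ˡ ∘ I⊆J ∘ ∈-++⁺ˡ) (select⇒M b (to T b ind)))
      ... | S , inside , refl | T , b , refl
        with here ← ∈-++⁻ʳ {S = T} (I⊆J (∈-++⁺ʳ {S = S} here))
        = from S inside (⊆-indep N (∈-++⁻ˡ ∘ I⊆J ∘ ∈-++⁺ˡ) (to T inside ind))

      Augmentation : Subset (m + 1) → Subset (m + 1) → Set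
      Augmentation I J = ∃[ i ] i ∈ J × i ∉ I × Ind (I ∪ ⁅ i ⁆)

      augmentˡ : ∀ {S T} {b b′ : Side} → ∃[ x ] x ∈ T × x ∉ S × Select b (S ∪ ⁅ x ⁆) →
                 Augmentation (S ++ b ∷ []) (T ++ b′ ∷ [])
      augmentˡ {S} {b = b} (x , x∈T , x∉S , sel) =
        x ↑ˡ 1 , ∈-++⁺ˡ x∈T , x∉S ∘ ∈-++⁻ˡ , subst Ind (sym (∪⁅↑ˡ⁆ S _ x)) (from (S ∪ ⁅ x ⁆) b sel)

      -- T itself may be dependent in L. Only the rank of the union matters, which is what the mixed
      -- cases of `aug` can control.
      augment-∪ : ∀ (L : Matroid m) {S T} → Indep L S → ∣ S ∣ < rank L (S ∪ T) →
                  ∃[ x ] x ∈ T × x ∉ S × Indep L (S ∪ ⁅ x ⁆)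
      augment-∪ L {S} {T} indS S<r with x , x∈ , x∉S , ind ← augment-rank L indS S<r
        = x , [ (λ x∈S → contradiction x∈S x∉S) , id ]′ (x∈p∪q⁻ S T x∈) , x∉S , ind

      aug : ∀ S (b : Side) T (b′ : Side) → Select b S → Select b′ T → ∣ S ∣ + ∣ b ∷ [] ∣ < ∣ T ∣ + ∣ b′ ∷ [] ∣ →
            Augmentation (S ++ b ∷ []) (T ++ b′ ∷ [])
      aug S outside T outside indS indT S<T =
        augmentˡ (augment M indS indT (ℕ.+-cancelʳ-< _ _ _ S<T))
      aug S inside T inside indS indT S<T =
        augmentˡ (augment N indS indT (ℕ.+-cancelʳ-< _ _ _ S<T))
      -- Here ∣ T ∣ ≥ ∣ S ∣ + 2 because the new element counts on the left. The gap bound costs at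
      -- most one, so r_N(S ∪ T) still exceeds ∣ S ∣.
      aug S inside T outside indS indT S<T = augmentˡ (augment-∪ N indS (ℕ.≤-pred (begin-strict
        suc ∣ S ∣              ≡⟨ ℕ.+-comm 1 ∣ S ∣ ⟩
        ∣ S ∣ + 1              <⟨ S<T ⟩
        ∣ T ∣ + 0              ≡⟨ ℕ.+-identityʳ ∣ T ∣ ⟩
        ∣ T ∣                  ≤⟨ ∣indep∣≤rank M indT (q⊆p∪q S T) ⟩
        rank M (S ∪ T)         ≤⟨ rank-gap≤1 (S ∪ T) ⟩
        suc (rank N (S ∪ T))   ∎)))
        where open ℕ.≤-Reasoning
      -- The new element itself can be added if S is independent in N. Otherwise the gap is positive
      -- on S, hence on S ∪ T, so r_M(S ∪ T) > r_N(S ∪ T) ≥ ∣ T ∣ ≥ ∣ S ∣.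
      aug S outside T inside indS indT S<T with indep? N S
      ... | yes indS′ = m ↑ʳ Fin.zero , ∈-++⁺ʳ {S = T} here , (λ e∈ → contradiction (∈-++⁻ʳ {S = S} e∈) λ ()) ,
        subst Ind (sym (∪⁅↑ʳ⁆ S _ Fin.zero)) (from S inside indS′)
      ... | no depS = augmentˡ (augment-∪ M indS (ℕ.+-cancelʳ-< _ _ _ (begin-strict
        ∣ S ∣ + rank N S            ≤⟨ ℕ.+-monoˡ-≤ _ S≤T ⟩
        ∣ T ∣ + rank N S            ≤⟨ ℕ.+-monoˡ-≤ _ (∣indep∣≤rank N indT (q⊆p∪q S T)) ⟩
        rank N (S ∪ T) + rank N S   <⟨ ℕ.+-monoʳ-< _ (dep⇒rank<∣∣ N depS) ⟩
        rank N (S ∪ T) + ∣ S ∣      ≤⟨ ℕ.+-monoʳ-≤ _ (∣indep∣≤rank M indS id) ⟩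
        rank N (S ∪ T) + rank M S   ≤⟨ rank-gap-mono (p⊆p∪q T) ⟩
        rank M (S ∪ T) + rank N S   ∎)))
        where
        open ℕ.≤-Reasoning
        S≤T : ∣ S ∣ ≤ ∣ T ∣
        S≤T = ℕ.≤-pred (begin-strict
          ∣ S ∣     ≡⟨ ℕ.+-identityʳ ∣ S ∣ ⟨
          ∣ S ∣ + 0 <⟨ S<T ⟩
          ∣ T ∣ + 1 ≡⟨ ℕ.+-comm ∣ T ∣ 1 ⟩
          suc ∣ T ∣ ∎)

      Ind-augment : ∀ {I J} → Ind I → Ind J → ∣ I ∣ < ∣ J ∣ → Augmentation I J
      Ind-augment {I} {J} indI indJ I<J with ++∷[]-view I | ++∷[]-view J
      ... | S , b , refl | T , b′ , refl
        rewrite ∣++∣ S (b ∷ []) | ∣++∣ T (b′ ∷ []) = aug S b T b′ (to S b indI) (to T b′ indJ) I<J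

      extension : Matroid (m + 1)
      extension = record
        { Indep   = Ind
        ; indep?  = λ U → select? (lookup U (m ↑ʳ Fin.zero)) (take m U)
        ; ⊥-indep = subst Ind (⊥++⊥ m 1) (from ⊥ outside (⊥-indep M))
        ; ⊆-indep = Ind-⊆
        ; augment = Ind-augment
        }

      -- The new element is not a loop because the empty set is independent in N. Hence the empty
      -- set is not a basis of the contracted set, and contraction sees only the sets governed by N.
      inside-basis : IsBasisOfX m 1 extension (inside ∷ [])
      inside-basis = from ⊥ inside (⊥-indep N) ,
        λ { {_ ∷ []} (_ , Fin.zero , _ , ∉) → contradiction here ∉ }

    strong⇒elementary : IsElementaryLift M N
    strong⇒elementary = extension ,
      (λ S → mk⇔ (to S outside) (from S outside)) ,
      (λ S → mk⇔ contract⇒N (λ ind → inside ∷ [] , inside-basis , from S inside ind))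
      where
      contract⇒N : ∀ {S} → Indep (contract m 1 extension) S → Indep N S
      contract⇒N {S} (inside  ∷ [] , _ , ind) = to S inside ind
      contract⇒N (outside ∷ [] , (_ , max) , _) =
        contradiction (proj₁ inside-basis) (max ((λ { (there ()) }) , Fin.zero , here , λ ()))

-- Partitions of abelian groups and elementary abelian groups

module _ {c ℓ : Level} (Γ : FiniteAbelianGroup c ℓ) where
  open FiniteAbelianGroup Γ renaming (ε to 1#; refl to ≈-refl; sym to ≈-sym; trans to ≈-trans)
  open Mult commutativeMonoid using (×-congʳ; ×-homo-1; ×-homo-+; ×-assocˡ; ×-distrib-+)
    renaming (_×_ to infixr 8 _·_)
  open GroupProperties group using (∙-cancelˡ; ∙-cancelʳ)
  open CommutativeSemigroup commutativeSemigroup using (interchange)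
  open import Relation.Binary.Reasoning.Setoid ≈-setoid

  to-injective : ∀ {x y} → Inverse.to enumeration x ≡ Inverse.to enumeration y → x ≈ y
  to-injective {x} {y} eq = begin
    x                                                   ≈⟨ Inverse.strictlyInverseʳ enumeration x ⟨
    Inverse.from enumeration (Inverse.to enumeration x) ≡⟨ cong (Inverse.from enumeration) eq ⟩
    Inverse.from enumeration (Inverse.to enumeration y) ≈⟨ Inverse.strictlyInverseʳ enumeration y ⟩
    y                                                   ∎

  infix 4 _≈?_
  _≈?_ : Decidable₂ _≈_
  x ≈? y = map′ to-injective (Inverse.to-cong enumeration) (Inverse.to enumeration x ≟ Inverse.to enumeration y)

  ·-1# : ∀ k → k · 1# ≈ 1#
  ·-1# zero    = ≈-refl
  ·-1# (suc k) = ≈-trans (identityˡ _) (·-1# k)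

  -- Two of the `order + 1` multiples `0 · x`, ..., `order · x` coincide.
  torsion : ∀ x → ∃[ k ] ℕ.NonZero k × k · x ≈ 1#
  torsion x with i , j , i<j , eq ← pigeonhole (ℕ.n<1+n order) (λ i → Inverse.to enumeration (toℕ i · x))
    = toℕ j ∸ toℕ i , ℕ.>-nonZero (ℕ.m<n⇒0<n∸m i<j) , ∙-cancelˡ (toℕ i · x) _ _ (begin
      toℕ i · x ∙ (toℕ j ∸ toℕ i) · x ≈⟨ ×-homo-+ x (toℕ i) (toℕ j ∸ toℕ i) ⟨
      (toℕ i + (toℕ j ∸ toℕ i)) · x   ≡⟨ cong (_· x) (ℕ.m+[n∸m]≡n (ℕ.<⇒≤ i<j)) ⟩
      toℕ j · x                       ≈⟨ to-injective eq ⟨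
      toℕ i · x                       ≈⟨ identityʳ _ ⟨
      toℕ i · x ∙ 1#                  ∎)

  -- Prime factors are stripped from an integer killing x until the remaining product no longer
  -- kills x. The element of prime order found this way is a multiple of x, so it stays in the part
  -- of x.
  multiple-of-prime-order : ∀ x → ¬ x ≈ 1# → ∃[ k ] ∃[ p ] Prime p × ¬ k · x ≈ 1# × p · k · x ≈ 1#
  multiple-of-prime-order x x≉1# =
    let k , k≢0 , kx≈1# = torsion x
        open PrimeFactorisation (factorise k {{k≢0}})
    in go factors factorsPrime (subst (λ k → k · x ≈ 1#) isFactorisation kx≈1#)
    where
    go : ∀ ps → All Prime ps → product ps · x ≈ 1# → ∃[ k ] ∃[ p ] Prime p × ¬ k · x ≈ 1# × p · k · x ≈ 1#
    go []       []              1x≈1# = contradiction (≈-trans (≈-sym (×-homo-1 x)) 1x≈1#) x≉1#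
    go (p ∷ ps) (p-prime ∷ primes) eq with product ps · x ≈? 1#
    ... | yes kx≈1# = go ps primes kx≈1#
    ... | no  kx≉1# = product ps , p , p-prime , kx≉1# , ≈-trans (×-assocˡ x p (product ps)) eq

  -- H α β says that β lies in the part of α; the parts are subgroups which
  -- pairwise meet only in the identity.
  record IsPartition {h} (H : Carrier → Carrier → Set h) : Set (c ⊔ ℓ ⊔ h) where
    field
      part?         : Decidable₂ H
      part-resp     : ∀ {α β γ} → β ≈ γ → H α β → H α γ
      part-refl     : ∀ {α} → H α α
      part-1#       : ∀ {α} → H α 1#
      part-∙        : ∀ {α β γ} → H α β → H α γ → H α (β ∙ γ)
      part-cancel   : ∀ {α β γ} → H α γ → H α (β ∙ γ) → H α β
      part-trans    : ∀ {α β γ} → H α β → H β γ → H α γ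
      part-exchange : ∀ {α β} → H α β → ¬ β ≈ 1# → H β α

    part-· : ∀ {α β} k → H α β → H α (k · β)
    part-· zero    _   = part-1#
    part-· (suc k) Hαβ = part-∙ Hαβ (part-· k Hαβ)

    -- If mα = 0 ≠ mβ, then mβ = m(α + β) puts α + β, hence α, in the part of β.
    same-torsion : ∀ {α β} m → ¬ H β α → m · α ≈ 1# → m · β ≈ 1#
    same-torsion {α} {β} m ¬Hβα mα≈1# = decidable-stable (m · β ≈? 1#) λ mβ≉1# →
      ¬Hβα (part-cancel part-refl (part-trans (part-· m part-refl)
        (part-exchange (part-resp m[α∙β]≈mβ (part-· m part-refl)) mβ≉1#)))
      where
      m[α∙β]≈mβ : m · (α ∙ β) ≈ m · β
      m[α∙β]≈mβ = begin
        m · (α ∙ β)   ≈⟨ ×-distrib-+ α β m ⟩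
        m · α ∙ m · β ≈⟨ ∙-congʳ mα≈1# ⟩
        1# ∙ m · β    ≈⟨ identityˡ _ ⟩
        m · β         ∎

    -- The multiple γ′ of γ has order p, and δ is outside its part. An α outside the part of γ′ is
    -- compared with γ′ directly. An α inside it is compared with δ, and δ with γ′.
    prime-exponent : ∀ {γ δ} → ¬ γ ≈ 1# → ¬ H γ δ →
      ∃[ p ] Prime p × (∀ α → p · α ≈ 1#) × ∃[ γ′ ] ¬ γ′ ≈ 1# × ¬ H γ′ δ
    prime-exponent {γ} {δ} γ≉1# ¬Hγδ with k , p , p-prime , γ′≉1# , pγ′≈1# ← multiple-of-prime-order γ γ≉1#
      = p , p-prime , exponent , k · γ , γ′≉1# , ¬Hγ′δ
      where
      ¬Hγ′δ : ¬ H (k · γ) δ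
      ¬Hγ′δ = ¬Hγδ ∘ part-trans (part-· k part-refl)

      exponent : ∀ α → p · α ≈ 1#
      exponent α with part? (k · γ) α
      ... | no  ¬Hγ′α = same-torsion p (λ Hαγ′ → ¬Hγ′α (part-exchange Hαγ′ γ′≉1#)) pγ′≈1#
      ... | yes Hγ′α  = same-torsion p (¬Hγ′δ ∘ part-trans Hγ′α)
        (same-torsion p (λ Hδγ′ → ¬Hγ′δ (part-exchange Hδγ′ γ′≉1#)) pγ′≈1#)

  -- Spans, independence and bases modulo a prime

  lin : ∀ {j} → Vector Carrier j → Vector ℕ j → Carrier
  lin {zero}  b u = 1#
  lin {suc j} b u = u Fin.zero · b Fin.zero ∙ lin (b ∘ Fin.suc) (u ∘ Fin.suc)

  lin-+ : ∀ {j} (b : Vector Carrier j) u v → lin b (λ i → u i + v i) ≈ lin b u ∙ lin b v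
  lin-+ {zero}  b u v = ≈-sym (identityˡ 1#)
  lin-+ {suc j} b u v = ≈-trans
    (∙-cong (×-homo-+ (b Fin.zero) (u Fin.zero) (v Fin.zero)) (lin-+ (b ∘ Fin.suc) (u ∘ Fin.suc) (v ∘ Fin.suc)))
    (interchange _ _ _ _)

  lin-* : ∀ {j} (b : Vector Carrier j) k u → lin b (λ i → k * u i) ≈ k · lin b u
  lin-* {zero}  b k u = ≈-sym (·-1# k)
  lin-* {suc j} b k u = ≈-trans
    (∙-cong (≈-sym (×-assocˡ (b Fin.zero) k (u Fin.zero))) (lin-* (b ∘ Fin.suc) k (u ∘ Fin.suc)))
    (≈-sym (×-distrib-+ _ _ k))

  Span : ∀ {j} → Vector Carrier j → Carrier → Set ℓ
  Span b x = ∃[ u ] lin b u ≈ x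

  module _ {j : ℕ} (b : Vector Carrier j) where

    span-resp : ∀ {x y} → x ≈ y → Span b x → Span b y
    span-resp x≈y (u , eq) = u , ≈-trans eq x≈y

    span-∙ : ∀ {x y} → Span b x → Span b y → Span b (x ∙ y)
    span-∙ (u , eq) (v , eq′) = _ , ≈-trans (lin-+ b u v) (∙-cong eq eq′)

    span-· : ∀ k {x} → Span b x → Span b (k · x)
    span-· k (u , eq) = _ , ≈-trans (lin-* b k u) (×-congʳ k eq)

    span-1# : Span b 1#
    span-1# = span-· 0 ((λ _ → 0) , ≈-refl)

  span-tail : ∀ {j x} (b : Vector Carrier (suc j)) → Span (b ∘ Fin.suc) x → Span b x
  span-tail b (u , eq) = (0 ◂ u) , ≈-trans (identityˡ _) eq

  span-head : ∀ {j} (b : Vector Carrier (suc j)) → Span b (b Fin.zero)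
  span-head b = (1 ◂ proj₁ (span-1# (b ∘ Fin.suc))) ,
    ≈-trans (∙-cong (×-homo-1 _) (proj₂ (span-1# (b ∘ Fin.suc)))) (identityʳ _)

  module _ (q : ℕ) (p-prime : Prime (suc q)) (exponent : ∀ x → suc q · x ≈ 1#) where
    private
      p : ℕ
      p = suc q

    ∣⇒·≈1# : ∀ {k} → p ℕ∣.∣ k → ∀ x → k · x ≈ 1#
    ∣⇒·≈1# (ℕ∣.divides k refl) x = ≈-trans (≈-sym (×-assocˡ x k p)) (≈-trans (×-congʳ k (exponent x)) (·-1# k))

    %-· : ∀ k x → (k % p) · x ≈ k · x
    %-· k x = begin
      (k % p) · x                   ≈⟨ identityʳ _ ⟨
      (k % p) · x ∙ 1#              ≈⟨ ∙-congˡ (∣⇒·≈1# (ℕ∣.divides (k / p) refl) x) ⟨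
      (k % p) · x ∙ (k / p * p) · x ≈⟨ ×-homo-+ x (k % p) (k / p * p) ⟨
      (k % p + k / p * p) · x       ≡⟨ cong (_· x) (m≡m%n+[m/n]*n k p) ⟨
      k · x                         ∎

    -- As q + 1 = p kills every element, `q · y` is the inverse of y. Subtraction is thus expressed
    -- with natural coefficients throughout.
    ∙-q·-cancel : ∀ x y → (x ∙ y) ∙ q · y ≈ x
    ∙-q·-cancel x y = ≈-trans (assoc x y _) (≈-trans (∙-congˡ (exponent y)) (identityʳ x))

    span-cancel : ∀ {j} (b : Vector Carrier j) {x y} → Span b y → Span b (x ∙ y) → Span b x
    span-cancel b {x} {y} spy spxy = span-resp b (∙-q·-cancel x y) (span-∙ b spxy (span-· b q spy))

    span? : ∀ {j} (b : Vector Carrier j) x → Dec (Span b x)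
    span? {zero}  b x = map′ (λ x≈1# → (λ ()) , ≈-sym x≈1#) (λ (_ , eq) → ≈-sym eq) (x ≈? 1#)
    span? {suc j} b x = map′ to from (any? λ k → span? (b ∘ Fin.suc) (x ∙ toℕ k · b Fin.zero))
      where
      to : ∃[ k ] Span (b ∘ Fin.suc) (x ∙ toℕ {p} k · b Fin.zero) → Span b x
      to (k , sp) = span-cancel b (span-· b (toℕ k) (span-head b)) (span-tail b sp)

      from : Span b x → ∃[ k ] Span (b ∘ Fin.suc) (x ∙ toℕ {p} k · b Fin.zero)
      from (u , eq) = k , u ∘ Fin.suc , (begin
        l                                                ≈⟨ identityˡ l ⟨
        1# ∙ l                                           ≈⟨ ∙-congʳ (exponent (u₀ · b₀)) ⟨
        (u₀ · b₀ ∙ q · u₀ · b₀) ∙ l                      ≈⟨ swap ⟩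
        (u₀ · b₀ ∙ l) ∙ q · u₀ · b₀                      ≈⟨ ∙-cong eq (≈-trans (×-assocˡ b₀ q u₀) (≈-sym (%-· (q * u₀) b₀))) ⟩
        x ∙ ((q * u₀) % p) · b₀                          ≡⟨ cong (λ k → x ∙ k · b₀) (toℕ-fromℕ< (m%n<n (q * u₀) p)) ⟨
        x ∙ toℕ k · b₀                                   ∎)
        where
        u₀ = u Fin.zero
        b₀ = b Fin.zero
        l = lin (b ∘ Fin.suc) (u ∘ Fin.suc)
        -- Since q is -1 modulo p, this is the residue of -u₀: adding it times b₀ to x removes the
        -- first term of the combination.
        k : Fin p
        k = fromℕ< (m%n<n (q * u₀) p)
        swap : (u₀ · b₀ ∙ q · u₀ · b₀) ∙ l ≈ (u₀ · b₀ ∙ l) ∙ q · u₀ · b₀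
        swap = ≈-trans (assoc _ _ _) (≈-trans (∙-congˡ (comm _ _)) (≈-sym (assoc _ _ _)))

    -- Coefficients are natural numbers that matter only modulo p, so divisibility by p takes the
    -- place of vanishing.
    Independent : ∀ {j} → Vector Carrier j → Set ℓ
    Independent b = ∀ u → lin b u ≈ 1# → ∀ i → p ℕ∣.∣ u i

    ∤⇒coprime : ∀ {k} → ¬ p ℕ∣.∣ k → Coprime k p
    ∤⇒coprime p∤k (d∣k , d∣p) with prime⇒irreducible p-prime d∣p
    ... | inj₁ d≡1  = d≡1
    ... | inj₂ refl = contradiction d∣k p∤k

    -- k is invertible modulo p. Bézout's identity over the naturals gives s with sk ≡ 1 or sk ≡ -1
    -- modulo p; in the second case `s · k · x` is the inverse of x.
    span-divide : ∀ {j} (b : Vector Carrier j) {x} k → ¬ p ℕ∣.∣ k → Span b (k · x) → Span b x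
    span-divide b {x} k p∤k sp with coprime-Bézout (∤⇒coprime p∤k)
    ... | Bézout.Identity.+- s t eq = span-resp b (begin
      s · k · x           ≈⟨ ×-assocˡ x s k ⟩
      (s * k) · x         ≡⟨ cong (_· x) eq ⟨
      x ∙ (t * p) · x     ≈⟨ ∙-congˡ (∣⇒·≈1# (ℕ∣.divides t refl) x) ⟩
      x ∙ 1#              ≈⟨ identityʳ x ⟩
      x                   ∎) (span-· b s sp)
    ... | Bézout.Identity.-+ s t eq = span-cancel b (span-· b s sp) (span-resp b (begin
      1#              ≈⟨ ∣⇒·≈1# (ℕ∣.divides t refl) x ⟨
      (t * p) · x     ≡⟨ cong (_· x) eq ⟨
      x ∙ (s * k) · x ≈⟨ ∙-congˡ (×-assocˡ x s k) ⟨
      x ∙ s · k · x   ∎) (span-1# b))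

    independent-◂ : ∀ {j} (b : Vector Carrier j) x → Independent b → ¬ Span b x → Independent (x ◂ b)
    independent-◂ b x ind x∉ u eq with p ℕ∣.∣? u Fin.zero
    ... | no  p∤u₀ = contradiction
      (span-divide b (u Fin.zero) p∤u₀ (span-cancel b (_ , ≈-refl) (span-resp b (≈-sym eq) (span-1# b)))) x∉
    ... | yes p∣u₀ = λ where
      Fin.zero    → p∣u₀
      (Fin.suc i) → ind (u ∘ Fin.suc) (≈-trans (≈-sym (identityˡ _))
                      (≈-trans (∙-congʳ (≈-sym (∣⇒·≈1# p∣u₀ x))) eq)) i

    -- Each xs i outside the current span is added to the family. The bound j ≤ j′ preserves the
    -- size of the initial family, from which 2 ≤ j is later obtained.
    extend-basis : ∀ {j k} (b : Vector Carrier j) → Independent b → (xs : Vector Carrier k) →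
      ∃[ j′ ] j ≤ j′ × ∃[ b′ ] Independent {j′} b′ × (∀ {x} → Span b x → Span b′ x) × (∀ i → Span b′ (xs i))
    extend-basis {j} {zero}  b ind xs = j , ℕ.≤-refl , b , ind , id , λ ()
    extend-basis {j} {suc k} b ind xs with span? b (xs Fin.zero)
    ... | yes sp =
      let j′ , j≤j′ , b′ , ind′ , mono , spans = extend-basis b ind (xs ∘ Fin.suc)
      in j′ , j≤j′ , b′ , ind′ , mono , λ { Fin.zero → mono sp ; (Fin.suc i) → spans i }
    ... | no ¬sp =
      let b₁ = xs Fin.zero ◂ b
          j′ , j<j′ , b′ , ind′ , mono , spans = extend-basis b₁ (independent-◂ b (xs Fin.zero) ind ¬sp) (xs ∘ Fin.suc)
      in j′ , ℕ.<⇒≤ j<j′ , b′ , ind′ , mono ∘ span-tail b₁ ,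
         λ { Fin.zero → mono (span-head b₁) ; (Fin.suc i) → spans i }

    module _ {j : ℕ} {b : Vector Carrier j} (ind : Independent b)
             (spans : ∀ i → Span b (Inverse.from enumeration i)) where

      private
        module ℤₚ = AbelianGroup (ℤ/ p)

        coord : Carrier → Vector ℕ j
        coord x = proj₁ (spans (Inverse.to enumeration x))

        lin-coord : ∀ x → lin b (coord x) ≈ x
        lin-coord x = ≈-trans (proj₂ (spans (Inverse.to enumeration x))) (Inverse.strictlyInverseʳ enumeration x)

        -- u + qv is the natural number standing for u - v; the two differ by a multiple of p.
        q·-difference : ∀ u v → pos (u + q * v) ≡ (pos u ℤ.- pos v) ℤ.+ pos p ℤ.* pos v
        q·-difference u v = trans (cong (λ z → pos u ℤ.+ z) (ℤ.pos-* q v)) (rearrange (pos u) (pos q) (pos v))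
          where
          rearrange : ∀ u q v → u ℤ.+ q ℤ.* v ≡ (u ℤ.- v) ℤ.+ (ℤ.1ℤ ℤ.+ q) ℤ.* v
          rearrange = solve-∀

        p∣p* : ∀ k → pos p ℤ∣.∣ pos p ℤ.* pos k
        p∣p* k = ℤ∣.divides (pos k) (ℤ.*-comm (pos p) (pos k))

        -- The chosen coordinates are arbitrary, but this makes them unique modulo p, which yields
        -- that `f` is well defined, a homomorphism and surjective.
        ≈⇒coeff-≈ : ∀ u v → lin b u ≈ lin b v → ∀ i → pos (u i) ℤₚ.≈ pos (v i)
        ≈⇒coeff-≈ u v u≈v i = ℤ∣.∣m+n∣n⇒∣m {pos p}
          (subst (pos p ℤ∣.∣_) (q·-difference (u i) (v i)) (ℤ∣.∣ᵤ⇒∣ (ind w w≈1# i))) (p∣p* (v i))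
          where
          w = λ i → u i + q * v i
          w≈1# : lin b w ≈ 1#
          w≈1# = begin
            lin b w                         ≈⟨ lin-+ b u (λ i → q * v i) ⟩
            lin b u ∙ lin b (λ i → q * v i) ≈⟨ ∙-cong u≈v (lin-* b q v) ⟩
            lin b v ∙ q · lin b v           ≈⟨ exponent (lin b v) ⟩
            1#                              ∎

        ∣⇒lin≈1# : ∀ {j} (b : Vector Carrier j) u → (∀ i → p ℕ∣.∣ u i) → lin b u ≈ 1#
        ∣⇒lin≈1# {zero}  b u p∣u = ≈-refl
        ∣⇒lin≈1# {suc j} b u p∣u = ≈-trans
          (∙-cong (∣⇒·≈1# (p∣u Fin.zero) (b Fin.zero)) (∣⇒lin≈1# (b ∘ Fin.suc) (u ∘ Fin.suc) (p∣u ∘ Fin.suc)))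
          (identityˡ 1#)

        coeff-≈⇒≈ : ∀ u v → (∀ i → pos (u i) ℤₚ.≈ pos (v i)) → lin b u ≈ lin b v
        coeff-≈⇒≈ u v u≈v = ∙-cancelʳ (q · lin b v) _ _ (begin
          lin b u ∙ q · lin b v           ≈⟨ ∙-congˡ (lin-* b q v) ⟨
          lin b u ∙ lin b (λ i → q * v i) ≈⟨ lin-+ b u (λ i → q * v i) ⟨
          lin b (λ i → u i + q * v i)     ≈⟨ ∣⇒lin≈1# b _ p∣u+qv ⟩
          1#                              ≈⟨ exponent (lin b v) ⟨
          lin b v ∙ q · lin b v           ∎)
          where
          p∣u+qv : ∀ i → p ℕ∣.∣ u i + q * v i
          p∣u+qv i = ℤ∣.∣⇒∣ᵤ (subst (pos p ℤ∣.∣_) (sym (q·-difference (u i) (v i)))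
            (ℤ∣.∣m∣n⇒∣m+n (u≈v i) (p∣p* (v i))))

        f : Carrier → Vector ℤ j
        f x i = pos (coord x i)

        f-cong : ∀ {x y} → x ≈ y → ∀ i → f x i ℤₚ.≈ f y i
        f-cong x≈y i = ≈⇒coeff-≈ (coord _) (coord _) (≈-trans (lin-coord _) (≈-trans x≈y (≈-sym (lin-coord _)))) i

        f-homo : ∀ x y i → f (x ∙ y) i ℤₚ.≈ f x i ℤ.+ f y i
        f-homo x y = ≈⇒coeff-≈ (coord (x ∙ y)) (λ i → coord x i + coord y i)
          (≈-trans (lin-coord _) (≈-sym (≈-trans (lin-+ b (coord x) (coord y)) (∙-cong (lin-coord x) (lin-coord y)))))

        f-1# : ∀ i → f 1# i ℤₚ.≈ ℤ.0ℤ
        f-1# = ≈⇒coeff-≈ (coord 1#) (λ _ → 0) (≈-trans (lin-coord 1#) (≈-sym (lin-* b 0 (λ _ → 0))))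

        f-⁻¹ : ∀ x i → f (x ⁻¹) i ℤₚ.≈ ℤ.- f x i
        f-⁻¹ x i = GroupProperties.inverseˡ-unique ℤₚ.group (f (x ⁻¹) i) (f x i)
          (ℤₚ.trans {f (x ⁻¹) i ℤ.+ f x i} {f (x ⁻¹ ∙ x) i} {ℤ.0ℤ}
            (ℤₚ.sym {f (x ⁻¹ ∙ x) i} {f (x ⁻¹) i ℤ.+ f x i} (f-homo (x ⁻¹) x i))
            (ℤₚ.trans {f (x ⁻¹ ∙ x) i} {f 1# i} {ℤ.0ℤ} (f-cong (inverseˡ x) i) (f-1# i)))

        f-injective : ∀ {x y} → (∀ i → f x i ℤₚ.≈ f y i) → x ≈ y
        f-injective {x} {y} fx≈fy =
          ≈-trans (≈-sym (lin-coord x)) (≈-trans (coeff-≈⇒≈ (coord x) (coord y) fx≈fy) (lin-coord y))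

        residue : ∀ z → pos (z ℤ.%ℕ p) ℤₚ.≈ z
        residue z = ℤₚ.sym {z} (ℤ∣.divides (z ℤ./ℕ p)
          (trans (cong (λ y → y ℤ.- pos (z ℤ.%ℕ p)) (ℤ.a≡a%ℕn+[a/ℕn]*n z p)) (cancel (pos (z ℤ.%ℕ p)) _)))
          where
          cancel : ∀ r s → (r ℤ.+ s) ℤ.- r ≡ s
          cancel = solve-∀

        f-surjective : ∀ (v : Vector ℤ j) → ∃[ x ] (∀ {z} → z ≈ x → ∀ i → f z i ℤₚ.≈ v i)
        f-surjective v = lin b w , λ {z} z≈x i →
          ℤₚ.trans {f z i} {pos (w i)} {v i} (≈⇒coeff-≈ (coord z) w (≈-trans (lin-coord z) z≈x) i) (residue (v i))
          where w = λ i → v i ℤ.%ℕ p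

      basis⇒≅ : abelianGroup ≅ (ℤ/ p ^⊕ j)
      basis⇒≅ = f , record
        { isGroupMonomorphism = record
          { isGroupHomomorphism = record
            { isMonoidHomomorphism = record
              { isMagmaHomomorphism = record
                { isRelHomomorphism = record { cong = f-cong }
                ; homo = f-homo
                }
              ; ε-homo = f-1#
              }
            ; ⁻¹-homo = f-⁻¹
            }
          ; injective = f-injective
          }
        ; surjective = f-surjective
        }

    -- The basis is grown from x and y, which are independent because y is outside the span of x.
    -- This forces at least two coordinates.
    elementary-abelian : ∀ {x y} → ¬ x ≈ 1# → (∀ k → ¬ k · x ≈ y) → ∃[ j ] 2 ≤ j × abelianGroup ≅ (ℤ/ p ^⊕ j)
    elementary-abelian {x} {y} x≉1# y∉ =
      let j , 2≤j , b , ind , _ , spans = extend-basis (y ◂ x ◂ []ᵥ)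
            (independent-◂ (x ◂ []ᵥ) y (independent-◂ []ᵥ x (λ _ _ ()) (λ (_ , 1#≈x) → x≉1# (≈-sym 1#≈x)))
              (λ (u , eq) → y∉ (u Fin.zero) (≈-trans (≈-sym (identityʳ _)) eq)))
            (Inverse.from enumeration)
      in j , 2≤j , basis⇒≅ ind spans

  -- The part of γ′ contains all multiples of γ′, so δ is not one of them.
  partition⇒elementary-abelian : ∀ {h} {H : Carrier → Carrier → Set h} → IsPartition H →
    ∀ {γ δ} → ¬ γ ≈ 1# → ¬ H γ δ → ∃[ p ] ∃[ j ] Prime p × 2 ≤ j × abelianGroup ≅ (ℤ/ p ^⊕ j)
  partition⇒elementary-abelian {H = H} isPartition γ≉1# ¬Hγδ
    with IsPartition.prime-exponent isPartition γ≉1# ¬Hγδ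
  ... | zero  , p-prime , _ = contradiction p-prime ¬prime[0]
  ... | suc q , p-prime , exponent , γ′ , γ′≉1# , ¬Hγ′δ =
    let open IsPartition isPartition
        j , 2≤j , iso = elementary-abelian q p-prime exponent γ′≉1#
          (λ k kγ′≈δ → ¬Hγ′δ (part-resp kγ′≈δ (part-· k part-refl)))
    in suc q , j , p-prime , 2≤j , iso

-- Arcs, triangles and digons of K_n^Γ

module _ {m : ℕ} {p : Level} {P : Pred (Fin m) p} (P? : Decidable P) where

  subset : Subset m
  subset = tabulate (does ∘ P?)

  ∈-subset⁺ : ∀ {x} → P x → x ∈ subset
  ∈-subset⁺ {x} Px = lookup⇒[]= x subset (trans (lookup∘tabulate (does ∘ P?) x) (dec-true (P? x) Px))

  ∈-subset⁻ : ∀ {x} → x ∈ subset → P x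
  ∈-subset⁻ {x} x∈ = decidable-stable (P? x) λ ¬Px →
    contradiction (trans (sym ([]=⇒lookup x∈)) (trans (lookup∘tabulate (does ∘ P?) x) (dec-false (P? x) ¬Px)))
      λ ()

module GainGraph {c ℓ : Level} (Γ : FiniteAbelianGroup c ℓ) (n : ℕ) where
  open FiniteAbelianGroup Γ renaming (ε to 1#; refl to ≈-refl; sym to ≈-sym; trans to ≈-trans)
  open GroupProperties group using (inverseˡ-unique; inverseʳ-unique; ⁻¹-involutive)

  G : Graph
  G = K Γ n

  open Graph G

  record IsArc (e : Fin edges) (i j : Fin n) (α : Carrier) : Set ℓ where
    constructor mkArc
    field
      tail≡  : tail e ≡ i
      head≡  : head e ≡ j
      label≈ : label Γ n e ≈ α

  tail<head : ∀ e → tail e Fin.< head e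
  tail<head e = proj₂ (∈-filter⁻ (λ (i , j , _) → i <? j)
    {xs = cartesianProduct (allFin n) (cartesianProduct (allFin n) (allFin order))} (∈-lookup {xs = edgeList Γ n} e))

  arc-< : ∀ {e i j α} → IsArc e i j α → i Fin.< j
  arc-< {e} arc-e = ≡.subst₂ Fin._<_ (IsArc.tail≡ arc-e) (IsArc.head≡ arc-e) (tail<head e)

  arc-resp : ∀ {e i j α β} → α ≈ β → IsArc e i j α → IsArc e i j β
  arc-resp α≈β (mkArc tail≡ head≡ label≈) = mkArc tail≡ head≡ (≈-trans label≈ α≈β)

  arc : ∀ {i j} → i Fin.< j → ∀ α → ∃[ e ] IsArc e i j α
  arc {i} {j} i<j α = index mem , mkArc
      (cong proj₁ (sym eq)) (cong (proj₁ ∘ proj₂) (sym eq))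
      (≈-trans (reflexive (cong (Inverse.from enumeration ∘ proj₂ ∘ proj₂) (sym eq)))
        (Inverse.strictlyInverseʳ enumeration α))
    where
    mem : (i , j , Inverse.to enumeration α) ∈ₗ edgeList Γ n
    mem = ∈-filter⁺ (λ (i , j , _) → i <? j)
      (∈-cartesianProduct⁺ (∈-allFin i) (∈-cartesianProduct⁺ (∈-allFin j) (∈-allFin _))) i<j
    eq : (i , j , Inverse.to enumeration α) ≡ List.lookup (edgeList Γ n) (index mem)
    eq = lookup-index mem

  ∈-step⁻ : ∀ {u v w} (s : Step G u v) (W : Walk G v w) {e} →
            e ∈ edgeSet (s ◅ W) → e ≡ stepEdge s ⊎ e ∈ edgeSet W
  ∈-step⁻ s W e∈ with x∈p∪q⁻ ⁅ stepEdge s ⁆ (edgeSet W) e∈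
  ... | inj₁ e∈s = inj₁ (x∈⁅y⁆⇒x≡y _ e∈s)
  ... | inj₂ e∈W = inj₂ e∈W

  step-∈ : ∀ {u v w} (s : Step G u v) (W : Walk G v w) → stepEdge s ∈ edgeSet (s ◅ W)
  step-∈ s W = p⊆p∪q (edgeSet W) (x∈⁅x⁆ _)

  edgeSet-tail : ∀ {u v w} (s : Step G u v) (W : Walk G v w) → edgeSet W ⊆ edgeSet (s ◅ W)
  edgeSet-tail s W = q⊆p∪q ⁅ stepEdge s ⁆ (edgeSet W)

  unit-walk : ∀ {u v} (W : Walk G u v) → (∀ {e} → e ∈ edgeSet W → label Γ n e ≈ 1#) → φ Γ n W ≈ 1#
  unit-walk ε       unit = ≈-refl
  unit-walk (s ◅ W) unit = ≈-trans
    (∙-cong (stepGain≈1 s (unit (step-∈ s W))) (unit-walk W (unit ∘ edgeSet-tail s W))) (identityˡ 1#)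
    where
    stepGain≈1 : ∀ {u v} (s : Step G u v) → label Γ n (stepEdge s) ≈ 1# → stepGain Γ n s ≈ 1#
    stepGain≈1 (forward  e _ _) eq = eq
    stepGain≈1 (backward e _ _) eq = ≈-sym (inverseʳ-unique _ _ (≈-trans (identityʳ _) eq))

  module _ {e f g : Fin edges} {i j k : Fin n} {α β γ : Carrier}
           (arc-e : IsArc e i j α) (arc-f : IsArc f j k β) (arc-g : IsArc g i k γ) where

    private
      step-e : Step G i j
      step-e = forward e (IsArc.tail≡ arc-e) (IsArc.head≡ arc-e)
      step-f : Step G j k
      step-f = forward f (IsArc.tail≡ arc-f) (IsArc.head≡ arc-f)
      step-g : Step G k i
      step-g = backward g (IsArc.head≡ arc-g) (IsArc.tail≡ arc-g)

    triangle : Walk G i i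
    triangle = step-e ◅ step-f ◅ step-g ◅ ε

    triangle-simple : IsSimpleClosed triangle
    triangle-simple = record
      { nonempty         = λ ()
      ; distinctVertices = (i≢j ∷ i≢k ∷ []) ∷ (j≢k ∷ []) ∷ [] ∷ []
      ; distinctEdges    = (e≢f ∷ e≢g ∷ []) ∷ (f≢g ∷ []) ∷ [] ∷ []
      }
      where
      i≢j : i ≢ j
      i≢j = <⇒≢ (arc-< arc-e)
      i≢k : i ≢ k
      i≢k = <⇒≢ (arc-< arc-g)
      j≢k : j ≢ k
      j≢k = <⇒≢ (arc-< arc-f)
      e≢f : e ≢ f
      e≢f refl = i≢j (trans (sym (IsArc.tail≡ arc-e)) (IsArc.tail≡ arc-f))
      e≢g : e ≢ g
      e≢g refl = j≢k (trans (sym (IsArc.head≡ arc-e)) (IsArc.head≡ arc-g))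
      f≢g : f ≢ g
      f≢g refl = i≢j (trans (sym (IsArc.tail≡ arc-g)) (IsArc.tail≡ arc-f))

    e∈triangle : e ∈ edgeSet triangle
    e∈triangle = step-∈ step-e (step-f ◅ step-g ◅ ε)

    f∈triangle : f ∈ edgeSet triangle
    f∈triangle = edgeSet-tail step-e (step-f ◅ step-g ◅ ε) (step-∈ step-f (step-g ◅ ε))

    g∈triangle : g ∈ edgeSet triangle
    g∈triangle = edgeSet-tail step-e (step-f ◅ step-g ◅ ε) (edgeSet-tail step-f (step-g ◅ ε) (step-∈ step-g ε))

    ∈-triangle⁻ : ∀ {h} → h ∈ edgeSet triangle → h ≡ e ⊎ h ≡ f ⊎ h ≡ g
    ∈-triangle⁻ h∈ with ∈-step⁻ step-e (step-f ◅ step-g ◅ ε) h∈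
    ... | inj₁ h≡e = inj₁ h≡e
    ... | inj₂ h∈′ with ∈-step⁻ step-f (step-g ◅ ε) h∈′
    ...   | inj₁ h≡f = inj₂ (inj₁ h≡f)
    ...   | inj₂ h∈″ with ∈-step⁻ step-g ε h∈″
    ...     | inj₁ h≡g = inj₂ (inj₂ h≡g)
    ...     | inj₂ h∈⊥ = contradiction h∈⊥ ∉⊥

    triangle-balanced : α ∙ β ≈ γ → φ Γ n triangle ≈ 1#
    triangle-balanced αβ≈γ = begin
      label Γ n e ∙ (label Γ n f ∙ (label Γ n g ⁻¹ ∙ 1#)) ≈⟨ ∙-cong (IsArc.label≈ arc-e) (∙-cong (IsArc.label≈ arc-f)
                                                              (≈-trans (identityʳ _) (⁻¹-cong (IsArc.label≈ arc-g)))) ⟩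
      α ∙ (β ∙ γ ⁻¹)                                      ≈⟨ assoc α β (γ ⁻¹) ⟨
      (α ∙ β) ∙ γ ⁻¹                                      ≈⟨ ∙-congʳ αβ≈γ ⟩
      γ ∙ γ ⁻¹                                            ≈⟨ inverseʳ γ ⟩
      1#                                                  ∎
      where open import Relation.Binary.Reasoning.Setoid ≈-setoid

  module _ {e f : Fin edges} {i j : Fin n} {α β : Carrier}
           (arc-e : IsArc e i j α) (arc-f : IsArc f i j β) (α≉β : ¬ α ≈ β) where

    private
      step-e : Step G i j
      step-e = forward e (IsArc.tail≡ arc-e) (IsArc.head≡ arc-e)
      step-f : Step G j i
      step-f = backward f (IsArc.head≡ arc-f) (IsArc.tail≡ arc-f)

    digon : Walk G i i
    digon = step-e ◅ step-f ◅ ε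

    ∈-digon⁻ : ∀ {g} → g ∈ edgeSet digon → g ≡ e ⊎ g ≡ f
    ∈-digon⁻ g∈ with ∈-step⁻ step-e (step-f ◅ ε) g∈
    ... | inj₁ g≡e = inj₁ g≡e
    ... | inj₂ g∈f with ∈-step⁻ step-f ε g∈f
    ...   | inj₁ g≡f = inj₂ g≡f
    ...   | inj₂ g∈⊥ = contradiction g∈⊥ ∉⊥

    private
      i≢j : i ≢ j
      i≢j = <⇒≢ (arc-< arc-e)

      label-e≉label-f : ¬ label Γ n e ≈ label Γ n f
      label-e≉label-f eq = α≉β (≈-trans (≈-sym (IsArc.label≈ arc-e)) (≈-trans eq (IsArc.label≈ arc-f)))

      tail-digon : ∀ {g} → g ∈ edgeSet digon → tail g ≡ i
      tail-digon g∈ with ∈-digon⁻ g∈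
      ... | inj₁ refl = IsArc.tail≡ arc-e
      ... | inj₂ refl = IsArc.tail≡ arc-f

      head-digon : ∀ {g} → g ∈ edgeSet digon → head g ≡ j
      head-digon g∈ with ∈-digon⁻ g∈
      ... | inj₁ refl = IsArc.head≡ arc-e
      ... | inj₂ refl = IsArc.head≡ arc-f

      label-injective : ∀ {g h} → g ∈ edgeSet digon → h ∈ edgeSet digon → g ≢ h → ¬ label Γ n g ≈ label Γ n h
      label-injective g∈ h∈ g≢h with ∈-digon⁻ g∈ | ∈-digon⁻ h∈
      ... | inj₁ refl | inj₁ refl = contradiction refl g≢h
      ... | inj₁ refl | inj₂ refl = label-e≉label-f
      ... | inj₂ refl | inj₁ refl = label-e≉label-f ∘ ≈-sym
      ... | inj₂ refl | inj₂ refl = contradiction refl g≢h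

      at-most-two : ∀ {g h k} → g ∈ edgeSet digon → h ∈ edgeSet digon → k ∈ edgeSet digon →
                    g ≢ h → g ≢ k → h ≢ k → Empty
      at-most-two g∈ h∈ k∈ g≢h g≢k h≢k with ∈-digon⁻ g∈ | ∈-digon⁻ h∈ | ∈-digon⁻ k∈
      ... | inj₁ refl | inj₁ refl | _         = g≢h refl
      ... | inj₂ refl | inj₂ refl | _         = g≢h refl
      ... | inj₁ refl | inj₂ refl | inj₁ refl = g≢k refl
      ... | inj₁ refl | inj₂ refl | inj₂ refl = h≢k refl
      ... | inj₂ refl | inj₁ refl | inj₁ refl = h≢k refl
      ... | inj₂ refl | inj₁ refl | inj₂ refl = g≢k refl

    digon-isCycle : IsCycle G (edgeSet digon)
    digon-isCycle = i , digon , record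
      { nonempty         = λ ()
      ; distinctVertices = (i≢j ∷ []) ∷ [] ∷ []
      ; distinctEdges    = ((λ { refl → label-e≉label-f ≈-refl }) ∷ []) ∷ [] ∷ []
      } , refl

    -- Balance asks for some walk around the edge set, so all of them must be excluded. There are no
    -- loops, and distinct edges allow at most two steps. Both edges have the same tail and head, so
    -- they are traversed in opposite directions and the gain is a quotient of distinct labels.
    digon-unbalanced : ¬ IsBalanced Γ n (edgeSet digon)
    digon-unbalanced (v , W , (simple , W≡) , φ≈1) =
        go W (IsSimpleClosed.nonempty simple) (IsSimpleClosed.distinctEdges simple) (subst (_ ∈_) W≡) φ≈1
      where
      ∙⁻¹≈1⇒≈ : ∀ {x y} → x ∙ (y ⁻¹ ∙ 1#) ≈ 1# → x ≈ y
      ∙⁻¹≈1⇒≈ {x} {y} eq = ≈-trans (inverseˡ-unique x (y ⁻¹) (≈-trans (∙-congˡ (≈-sym (identityʳ _))) eq)) (⁻¹-involutive y)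

      go : ∀ {v} (W : Walk G v v) → W ≢ ε → Unique (walkEdges W) →
           (∀ {e} → e ∈ edgeSet W → e ∈ edgeSet digon) → ¬ φ Γ n W ≈ 1#
      go ε nonempty _ _ _ = nonempty refl
      go (forward  g refl h≡ ◅ ε) _ _ _ _ = <⇒≢ (tail<head g) (sym h≡)
      go (backward g refl t≡ ◅ ε) _ _ _ _ = <⇒≢ (tail<head g) t≡
      go (s ◅ t ◅ ε) _ ((s≢t ∷ []) ∷ _) W⊆ = two s t (W⊆ (step-∈ s (t ◅ ε)))
          (W⊆ (edgeSet-tail s (t ◅ ε) (step-∈ t ε))) s≢t
        where
        two : ∀ {u v} (s : Step G u v) (t : Step G v u) →
              stepEdge s ∈ edgeSet digon → stepEdge t ∈ edgeSet digon → stepEdge s ≢ stepEdge t →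
              ¬ stepGain Γ n s ∙ (stepGain Γ n t ∙ 1#) ≈ 1#
        two (forward g refl refl) (forward h t≡ _) g∈ h∈ _ _ =
          <⇒≢ (tail<head g) (trans (tail-digon g∈) (trans (sym (tail-digon h∈)) t≡))
        two (backward g refl refl) (backward h h≡ _) g∈ h∈ _ _ =
          <⇒≢ (tail<head g) (sym (trans (head-digon g∈) (trans (sym (head-digon h∈)) h≡)))
        two (forward g _ _) (backward h _ _) g∈ h∈ g≢h eq = label-injective g∈ h∈ g≢h (∙⁻¹≈1⇒≈ eq)
        two (backward g _ _) (forward h _ _) g∈ h∈ g≢h eq = label-injective h∈ g∈ (g≢h ∘ sym)
          (∙⁻¹≈1⇒≈ (≈-trans (≈-trans (∙-congˡ (identityʳ _)) (≈-trans (comm _ _) (∙-congˡ (≈-sym (identityʳ _))))) eq))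
      go (s ◅ t ◅ r ◅ W) _ ((s≢t ∷ s≢r ∷ _) ∷ (t≢r ∷ _) ∷ _) W⊆ _ = at-most-two
        (W⊆ (step-∈ s (t ◅ r ◅ W)))
        (W⊆ (edgeSet-tail s (t ◅ r ◅ W) (step-∈ t (r ◅ W))))
        (W⊆ (edgeSet-tail s (t ◅ r ◅ W) (edgeSet-tail t (r ◅ W) (step-∈ r W))))
        s≢t s≢r t≢r

-- Lifts in which a cycle is a circuit exactly when it is balanced

module BalancedLift {c ℓ : Level} (Γ : FiniteAbelianGroup c ℓ) (n : ℕ)
         {M N : Matroid (Graph.edges (K Γ n))} (strong : IsStrongMap M N)
         (graphic : IsGraphicMatroid (K Γ n) N)
         (balanced⇔circuit : ∀ C → IsCycle (K Γ n) C → IsCircuit M C ⇔ IsBalanced Γ n C) where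
  open FiniteAbelianGroup Γ renaming (ε to 1#; refl to ≈-refl; sym to ≈-sym; trans to ≈-trans)
  open Graph (K Γ n)
  open IsStrongMap strong
  open GainGraph Γ n

  unit? : Decidable (λ e → label Γ n e ≈ 1#)
  unit? e = _≈?_ Γ (label Γ n e) 1#

  E₁ : Subset edges
  E₁ = subset unit?

  unit∈E₁ : ∀ {e i j} → IsArc e i j 1# → e ∈ E₁
  unit∈E₁ arc-e = ∈-subset⁺ unit? (IsArc.label≈ arc-e)

  -- All cycles in E₁ are balanced, so M and N agree on E₁.
  rank-E₁ : rank M E₁ ≤ rank N E₁
  rank-E₁ = rank≤ M λ indM I⊆E₁ → ∣indep∣≤rank N (indepN indM I⊆E₁) I⊆E₁
    where
    indepN : ∀ {I} → Indep M I → I ⊆ E₁ → Indep N I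
    indepN {I} indM I⊆E₁ = decidable-stable (indep? N I) λ dep →
      let C , C⊆I , circuit = dep⇒circuit N dep
          v , W , around@(_ , W≡C) = Equivalence.to (graphic C) circuit
          φW≈1 = unit-walk W (∈-subset⁻ unit? ∘ I⊆E₁ ∘ C⊆I ∘ subst (_ ∈_) W≡C)
          depM , _ = Equivalence.from (balanced⇔circuit C (v , W , around)) (v , W , around , φW≈1)
      in depM (⊆-indep M C⊆I indM)

  -- Proper subsets of a cycle are independent in N, hence in M. If C were dependent, it would be a
  -- circuit of M and therefore balanced.
  unbalanced⇒indep : ∀ {C} → IsCycle (K Γ n) C → ¬ IsBalanced Γ n C → Indep M C
  unbalanced⇒indep {C} cycle unbalanced = decidable-stable (indep? M C) λ dep →
    unbalanced (Equivalence.to (balanced⇔circuit C cycle)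
      (dep , λ D⊂C → indep-preserved (proj₂ (Equivalence.from (graphic C) cycle) D⊂C)))

  -- C has positive gap, so E₁ ∪ {e} has positive gap by monotonicity. If e were in the closure of
  -- E₁, the gap would be no larger than on E₁, where there is none.
  unbalanced-∉cl-E₁ : ∀ {C e} → IsCycle (K Γ n) C → ¬ IsBalanced Γ n C → C ⊆ E₁ ∪ ⁅ e ⁆ → ¬ e ∈cl[ M ] E₁
  unbalanced-∉cl-E₁ {C} {e} cycle unbalanced C⊆ e∈cl =
    ℕ.<⇒≱ rankN<rankM (ℕ.≤-trans e∈cl (ℕ.≤-trans rank-E₁ (rank-mono N (p⊆p∪q ⁅ e ⁆))))
    where
    open ℕ.≤-Reasoning
    rankN<rankM : rank N (E₁ ∪ ⁅ e ⁆) < rank M (E₁ ∪ ⁅ e ⁆)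
    rankN<rankM = ℕ.+-cancelʳ-< (rank N C) _ _ (begin-strict
      rank N (E₁ ∪ ⁅ e ⁆) + rank N C <⟨ ℕ.+-monoʳ-< _ (dep⇒rank<∣∣ N (proj₁ (Equivalence.from (graphic C) cycle))) ⟩
      rank N (E₁ ∪ ⁅ e ⁆) + ∣ C ∣    ≤⟨ ℕ.+-monoʳ-≤ _ (∣indep∣≤rank M (unbalanced⇒indep cycle unbalanced) id) ⟩
      rank N (E₁ ∪ ⁅ e ⁆) + rank M C ≤⟨ rank-gap-mono strong C⊆ ⟩
      rank M (E₁ ∪ ⁅ e ⁆) + rank N C ∎)

  nonunit-∉cl-E₁ : ∀ {e i j α} → IsArc e i j α → ¬ α ≈ 1# → ¬ e ∈cl[ M ] E₁
  nonunit-∉cl-E₁ {e} arc-e α≉1 =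
    let u , arc-u = arc (arc-< arc-e) 1#
    in unbalanced-∉cl-E₁ (digon-isCycle arc-u arc-e (α≉1 ∘ ≈-sym)) (digon-unbalanced arc-u arc-e (α≉1 ∘ ≈-sym))
      λ g∈ → case (∈-digon⁻ arc-u arc-e (α≉1 ∘ ≈-sym) g∈) arc-u
    where
    case : ∀ {g u i j} → g ≡ u ⊎ g ≡ e → IsArc u i j 1# → g ∈ E₁ ∪ ⁅ e ⁆
    case (inj₁ refl) arc-u = p⊆p∪q ⁅ e ⁆ (unit∈E₁ arc-u)
    case (inj₂ refl) _     = q⊆p∪q E₁ ⁅ e ⁆ (x∈⁅x⁆ e)

  module _ {S : Subset edges} {e f g : Fin edges} {i j k : Fin n} {α β γ : Carrier}
           (arc-e : IsArc e i j α) (arc-f : IsArc f j k β) (arc-g : IsArc g i k γ)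
           (αβ≈γ : α ∙ β ≈ γ) where

    private
      Δ : Walk (K Γ n) i i
      Δ = triangle arc-e arc-f arc-g

      circuit : IsCircuit M (edgeSet Δ)
      circuit = Equivalence.from (balanced⇔circuit _ (i , Δ , simple , refl))
        (i , Δ , (simple , refl) , triangle-balanced arc-e arc-f arc-g αβ≈γ)
        where simple = triangle-simple arc-e arc-f arc-g

      triangle-cl : ∀ {h} → h ∈ edgeSet Δ → (e ≢ h → e ∈cl[ M ] S) → (f ≢ h → f ∈cl[ M ] S) →
                    (g ≢ h → g ∈cl[ M ] S) → h ∈cl[ M ] S
      triangle-cl {h} h∈ e∈ f∈ g∈ = circuit-cl-closed M circuit h∈ (case ∘ ∈-triangle⁻ arc-e arc-f arc-g)
        where
        case : ∀ {y} → y ≡ e ⊎ y ≡ f ⊎ y ≡ g → y ≢ h → y ∈cl[ M ] S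
        case (inj₁ refl)        = e∈
        case (inj₂ (inj₁ refl)) = f∈
        case (inj₂ (inj₂ refl)) = g∈

    triangle-cl₁ : f ∈cl[ M ] S → g ∈cl[ M ] S → e ∈cl[ M ] S
    triangle-cl₁ f∈ g∈ = triangle-cl (e∈triangle arc-e arc-f arc-g) (contradiction refl) (λ _ → f∈) (λ _ → g∈)

    triangle-cl₂ : e ∈cl[ M ] S → g ∈cl[ M ] S → f ∈cl[ M ] S
    triangle-cl₂ e∈ g∈ = triangle-cl (f∈triangle arc-e arc-f arc-g) (λ _ → e∈) (contradiction refl) (λ _ → g∈)

    triangle-cl₃ : e ∈cl[ M ] S → f ∈cl[ M ] S → g ∈cl[ M ] S
    triangle-cl₃ e∈ f∈ = triangle-cl (g∈triangle arc-e arc-f arc-g) (λ _ → e∈) (λ _ → f∈) (contradiction refl)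

-- The partition of Γ and the dichotomy

module _ {c ℓ : Level} (Γ : FiniteAbelianGroup c ℓ) (n₃ : ℕ)
         {M N : Matroid (Graph.edges (K Γ (3 + n₃)))} (strong : IsStrongMap M N)
         (graphic : IsGraphicMatroid (K Γ (3 + n₃)) N)
         (balanced⇔circuit : ∀ C → IsCycle (K Γ (3 + n₃)) C → IsCircuit M C ⇔ IsBalanced Γ (3 + n₃) C) where
  open FiniteAbelianGroup Γ renaming (ε to 1#; refl to ≈-refl; sym to ≈-sym; trans to ≈-trans)

  private
    n : ℕ
    n = 3 + n₃

  open Graph (K Γ n)
  open GainGraph Γ n
  open BalancedLift Γ n strong graphic balanced⇔circuit

  private
    v₀ v₁ v₂ : Fin n
    v₀ = Fin.zero
    v₁ = Fin.suc Fin.zero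
    v₂ = Fin.suc (Fin.suc Fin.zero)

  -- A name ij⇒kl says that the closure of S, if it contains an arc i → j, contains
  -- the arcs k → l with the same label.
  module Flat {S : Subset edges} (E⊆S : E₁ ⊆ S) where

    F : Fin edges → Set
    F e = e ∈cl[ M ] S

    unit : ∀ {i j} → i Fin.< j → ∃[ u ] IsArc u i j 1# × F u
    unit i<j = let u , arc-u = arc i<j 1#
               in u , arc-u , ∈⇒∈cl M (E⊆S (unit∈E₁ arc-u))

    01⇒0j : ∀ {e g j α} → v₁ Fin.< j → IsArc e v₀ v₁ α → IsArc g v₀ j α → F e → F g
    01⇒0j 1<j arc-e arc-g Fe = let u , arc-u , Fu = unit 1<j
      in triangle-cl₃ arc-e arc-u arc-g (identityʳ _) Fe Fu

    02⇒01 : ∀ {e g α} → IsArc g v₀ v₂ α → IsArc e v₀ v₁ α → F g → F e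
    02⇒01 arc-g arc-e Fg = let u , arc-u , Fu = unit (s<s z<s)
      in triangle-cl₁ arc-e arc-u arc-g (identityʳ _) Fu Fg

    0j⇒ij : ∀ {f g i j α} → v₀ Fin.< i → IsArc g v₀ j α → IsArc f i j α → F g → F f
    0j⇒ij 0<i arc-g arc-f Fg = let u , arc-u , Fu = unit 0<i
      in triangle-cl₂ arc-u arc-f arc-g (identityˡ _) Fu Fg

    01⇒12 : ∀ {e f α} → IsArc e v₀ v₁ α → IsArc f v₁ v₂ α → F e → F f
    01⇒12 {α = α} arc-e arc-f Fe = let g , arc-g = arc z<s α
      in 0j⇒ij z<s arc-g arc-f (01⇒0j (s<s z<s) arc-e arc-g Fe)

    -- The detour through v₂ avoids showing that an edge is determined by its ends and its label.
    01⇒01 : ∀ {e e′ α} → IsArc e v₀ v₁ α → IsArc e′ v₀ v₁ α → F e → F e′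
    01⇒01 {α = α} arc-e arc-e′ Fe = let g , arc-g = arc z<s α
      in 02⇒01 arc-g arc-e′ (01⇒0j (s<s z<s) arc-e arc-g Fe)

    01⇒0 : (∀ {e α} → IsArc e v₀ v₁ α → F e) → ∀ {g j α} → IsArc g v₀ j α → F g
    01⇒0 F01 {g} {Fin.zero} arc-g = ⊥-elim (ℕ.<-irrefl refl (arc-< arc-g))
    01⇒0 F01 {g} {Fin.suc Fin.zero} arc-g = F01 arc-g
    01⇒0 F01 {g} {Fin.suc (Fin.suc j)} {α} arc-g =
      let e , arc-e = arc z<s α in 01⇒0j (s<s z<s) arc-e arc-g (F01 arc-e)

    01⇒all : (∀ {e α} → IsArc e v₀ v₁ α → F e) → ∀ {f i j α} → IsArc f i j α → F f
    01⇒all F01 {i = Fin.zero} arc-f = 01⇒0 F01 arc-f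
    01⇒all F01 {f} {Fin.suc i} {j} {α} arc-f =
      let g , arc-g = arc (ℕ.≤-<-trans ℕ.z≤n (arc-< arc-f)) α in 0j⇒ij z<s arc-g arc-f (01⇒0 F01 arc-g)

  edge₀₁ : Carrier → Fin edges
  edge₀₁ α = proj₁ (arc {v₀} {v₁} z<s α)

  arc₀₁ : ∀ α → IsArc (edge₀₁ α) v₀ v₁ α
  arc₀₁ α = proj₂ (arc z<s α)

  -- In M / E₁, `edge₀₁ β` is a loop or parallel to `edge₀₁ α`; a loop occurs only for the identity.
  Part : Carrier → Carrier → Set
  Part α β = edge₀₁ β ∈cl[ M ] E₁ ∪ ⁅ edge₀₁ α ⁆

  module PartFlat (α : Carrier) = Flat {E₁ ∪ ⁅ edge₀₁ α ⁆} (p⊆p∪q ⁅ edge₀₁ α ⁆)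

  part-isPartition : IsPartition Γ Part
  part-isPartition = record
    { part?         = λ α β → _∈cl?_ M (edge₀₁ β) (E₁ ∪ ⁅ edge₀₁ α ⁆)
    ; part-resp     = λ {α} {β} {γ} β≈γ → PartFlat.01⇒01 α (arc-resp β≈γ (arc₀₁ β)) (arc₀₁ γ)
    ; part-refl     = λ {α} → ∈⇒∈cl M (x∈S∪⁅x⁆ E₁ (edge₀₁ α))
    ; part-1#        = λ {α} → ∈⇒∈cl M (p⊆p∪q ⁅ edge₀₁ α ⁆ (unit∈E₁ (arc₀₁ 1#)))
    -- The label γ is moved to the pair v₁, v₂, so that the balanced triangle on v₀, v₁, v₂ puts β ∙
    -- γ on the pair v₀, v₂; from there it is moved back to v₀, v₁.
    ; part-∙        = λ {α} {β} {γ} Fβ Fγ →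
        let f , arc-f = arc (s<s z<s) γ
            g , arc-g = arc z<s (β ∙ γ)
        in PartFlat.02⇒01 α arc-g (arc₀₁ (β ∙ γ))
             (triangle-cl₃ (arc₀₁ β) arc-f arc-g ≈-refl Fβ
               (PartFlat.01⇒12 α (arc₀₁ γ) arc-f Fγ))
    ; part-cancel   = λ {α} {β} {γ} Fγ Fβγ →
        let f , arc-f = arc (s<s z<s) γ
            g , arc-g = arc z<s (β ∙ γ)
        in triangle-cl₁ (arc₀₁ β) arc-f arc-g ≈-refl
             (PartFlat.01⇒12 α (arc₀₁ γ) arc-f Fγ)
             (PartFlat.01⇒0j α (s<s z<s) (arc₀₁ (β ∙ γ)) arc-g Fβγ)
    ; part-trans    = λ {α} {β} {γ} Fβ Fγ → cl-trans M
        (λ y∈ → trans-case {α} {β} Fβ (∈-∪⁅⁆⁻ y∈)) Fγ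
    -- Exchange over E₁ needs `edge₀₁ β` outside the closure of E₁, and the unbalanced digon
    -- provides this when β is not the identity.
    ; part-exchange = λ {α} {β} Fβ β≉1 → cl-exchange M Fβ (nonunit-∉cl-E₁ (arc₀₁ β) β≉1)
    }
    where
    trans-case : ∀ {α β y} → Part α β → y ∈ E₁ ⊎ y ≡ edge₀₁ β → y ∈cl[ M ] E₁ ∪ ⁅ edge₀₁ α ⁆
    trans-case {α} _  (inj₁ y∈E₁)  = ∈⇒∈cl M (p⊆p∪q ⁅ edge₀₁ α ⁆ y∈E₁)
    trans-case     Fβ (inj₂ refl) = Fβ

  single-part⇒gap≤1 : ∀ γ → (∀ β → Part γ β) → rank M ⊤ ≤ suc (rank N ⊤)
  single-part⇒gap≤1 γ all = begin
    rank M ⊤                         ≤⟨ rank-mono M (q⊆p∪q (E₁ ∪ ⁅ edge₀₁ γ ⁆) ⊤) ⟩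
    rank M ((E₁ ∪ ⁅ edge₀₁ γ ⁆) ∪ ⊤) ≤⟨ rank-∪-cl M (λ _ → PartFlat.01⇒all γ F01 (mkArc refl refl ≈-refl)) ⟩
    rank M (E₁ ∪ ⁅ edge₀₁ γ ⁆)       ≤⟨ rank-∪⁅⁆≤ M E₁ (edge₀₁ γ) ⟩
    suc (rank M E₁)                  ≤⟨ s≤s rank-E₁ ⟩
    suc (rank N E₁)                  ≤⟨ s≤s (rank-mono N (⊆-max E₁)) ⟩
    suc (rank N ⊤)                   ∎
    where
    open ℕ.≤-Reasoning
    F01 : ∀ {e α} → IsArc e v₀ v₁ α → e ∈cl[ M ] E₁ ∪ ⁅ edge₀₁ γ ⁆
    F01 {α = α} arc-e = PartFlat.01⇒01 γ (arc₀₁ α) arc-e (all α)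

  dichotomy : Nontrivial Γ →
    (∃[ p ] ∃[ j ] Prime p × 2 ≤ j × (abelianGroup ≅ (ℤ/ p ^⊕ j))) ⊎ IsElementaryLift M N
  dichotomy (γ , γ≉1) with any? (λ i → ¬? (IsPartition.part? part-isPartition γ (Inverse.from enumeration i)))
  ... | yes (i , ¬part) = inj₁ (partition⇒elementary-abelian Γ part-isPartition γ≉1 ¬part)
  -- The search covers only the enumerated representatives; `part-resp` passes from them to every β.
  ... | no  none = inj₂ (strong⇒elementary strong (single-part⇒gap≤1 γ λ β →
    IsPartition.part-resp part-isPartition {γ} (Inverse.strictlyInverseʳ enumeration β)
      (decidable-stable (IsPartition.part? part-isPartition γ _) λ ¬part → none (_ , ¬part))))

theorem1p4 : ∀ {c ℓ} (Γ : FiniteAbelianGroup c ℓ) → Nontrivial Γ →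
    (n : ℕ) → 3 ≤ n →
    (N : Matroid (Graph.edges (K Γ n))) → IsGraphicMatroid (K Γ n) N →
    (M : Matroid (Graph.edges (K Γ n))) → IsLift M N →
    (∀ C → IsCycle (K Γ n) C → (IsCircuit M C ⇔ IsBalanced Γ n C)) →
    (∃[ p ] ∃[ j ] Prime p × 2 ≤ j × (FiniteAbelianGroup.abelianGroup Γ ≅ (ℤ/ p ^⊕ j)))
    ⊎ IsElementaryLift M N
theorem1p4 Γ nontrivial _ (s≤s (s≤s (s≤s {n = n₃} _))) N graphic M lift balanced⇔circuit =
  dichotomy Γ n₃ {M} {N} (lift⇒strong lift) graphic balanced⇔circuit nontrivial
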